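{- Let $d\ge 2$ be an integer, let $p$ be a prime with $d\mid p-1$, and let $\lambda$ be an integer not divisible by $p$. For $\mu\in\{0,\lambda\}$ let $N_{\mathbb{F}_p}(\mu)$ be the number of $\mathbb{F}_p$-points of the hypersurface $x_1^d+x_2^d-d\mu\, x_1x_2^{d-1}=0$ in $\mathbb{P}^1_{\mathbb{F}_p}$. Put $\alpha_k=\frac{k}{d}$ for $1\le k\le d-1$ and $\beta_k=\frac{k}{d-1}$ for $1\le k\le d-2$, and for $0\le i\le d-2$ let $$\alpha^{(i)}=(\alpha_1+1,\dots,\alpha_i+1,\alpha_{i+1},\dots,\alpha_{d-1}),\qquad \beta^{(i)}=(\beta_1+1,\dots,\beta_i+1,\beta_{i+1},\dots,\beta_{d-2}).$$ Then $$N_{\mathbb{F}_p}(\lambda)-N_{\mathbb{F}_p}(0)\equiv\sum_{i=0}^{d-2}\left[{}_{d-1}F_{d-2}\left(\alpha^{(i)};\beta^{(i)}\,\middle|\,(d-1)^{ -(d-1)}\lambda^{ -d}\right)\right]_{\frac{i(p-1)}{d-1}}^{\frac{(i+1)(p-1)}{d}-1}\pmod p.$$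
   Context: The generalized hypergeometric series is $${}_AF_B(\alpha_1,\dots,\alpha_A;\beta_1,\dots,\beta_B|z)=\sum_{k=0}^{\infty}\frac{(\alpha_1)_k\cdots(\alpha_A)_k}{(\beta_1)_k\cdots(\beta_B)_k}\frac{z^k}{k!},\qquad (x)_k=x(x+1)\cdots(x+k-1),\ (x)_0=1.$$ For a power series $u(z)=\sum_k u_kz^k$, the notation $[u(z)]_a^b$ denotes the truncation $\sum_{a\le k\le b}u_kz^k$, the sum being over integers $k$ with $a\le k\le b$ (the bounds may be rational numbers). The congruence modulo $p$ is between elements of the ring $\mathbb{Z}_{(p)}$ of rational numbers with denominator prime to $p$. -}

module Defs where

open import Algebra.Definitions.RawSemiring using () renaming (_^_ to power)
open import Data.Fin.Base using (Fin; toℕ)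
open import Data.Fin.Properties using (any?)
open import Data.Integer.Base as ℤ using (ℤ; +_)
open import Data.Integer.Divisibility as ℤ using ()
open import Data.List.Base
  using (List; _++_; allFin; cartesianProduct; deduplicate; drop; filter; foldr; length; map; take; upTo)
open import Data.Nat.Base as ℕ using (ℕ; zero; suc; _∸_; _!)
open import Data.Nat.Coprimality using (Coprime)
open import Data.Nat.Divisibility using (_∣?_)
open import Data.Product.Base using (_×_; _,_; ∃; ∃-syntax)
open import Data.Rational.Base
  using (ℚ; 0ℚ; 1ℚ; _/_; _+_; _*_; _-_; _≤_; floor; 1/_; ≢-nonZero; ↧ₙ_; +-*-rawSemiring)
open import Data.Rational.Properties using (_≟_; _≤?_)
open import Relation.Binary.PropositionalEquality.Core using (_≡_)
open import Relation.Nullary.Decidable.Core using (Dec; yes; no; ¬?; _×-dec_)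
open import Relation.Nullary.Negation.Core using (¬_)

------------------------------------------------------------------------
-- Points of hypersurfaces in ℙ¹ over 𝔽ₚ

-- 𝔽ₚ is ℤ/pℤ: its elements are listed by the representatives 0, …, p - 1, and
-- an equation holds in 𝔽ₚ when the corresponding integer congruence does.
infix 4 _≡_[𝔽_] _≡?_[𝔽_]
_≡_[𝔽_] : ℤ → ℤ → ℕ → Set
a ≡ b [𝔽 p ] = + p ℤ.∣ a ℤ.- b

_≡?_[𝔽_] : ∀ a b p → Dec (a ≡ b [𝔽 p ])
a ≡? b [𝔽 p ] = p ∣? ℤ.∣ a ℤ.- b ∣

⌞_⌟ : ∀ {p} → Fin p → ℤ
⌞ x ⌟ = + toℕ x

𝔽² : ℕ → Set
𝔽² p = Fin p × Fin p

NonOrigin : ∀ {p} → 𝔽² p → Set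
NonOrigin {p} (x₁ , x₂) = ¬ (⌞ x₁ ⌟ ≡ + 0 [𝔽 p ] × ⌞ x₂ ⌟ ≡ + 0 [𝔽 p ])

nonOrigin? : ∀ {p} (x : 𝔽² p) → Dec (NonOrigin x)
nonOrigin? {p} (x₁ , x₂) = ¬? ((⌞ x₁ ⌟ ≡? + 0 [𝔽 p ]) ×-dec (⌞ x₂ ⌟ ≡? + 0 [𝔽 p ]))

-- Two nonzero vectors represent the same point of ℙ¹(𝔽ₚ).
infix 4 _∼_ _∼?_
_∼_ : ∀ {p} → 𝔽² p → 𝔽² p → Set
_∼_ {p} (x₁ , x₂) (y₁ , y₂) =
  ∃ λ (c : Fin p) →
    ¬ (⌞ c ⌟ ≡ + 0 [𝔽 p ])
      × ⌞ c ⌟ ℤ.* ⌞ x₁ ⌟ ≡ ⌞ y₁ ⌟ [𝔽 p ]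
      × ⌞ c ⌟ ℤ.* ⌞ x₂ ⌟ ≡ ⌞ y₂ ⌟ [𝔽 p ]

_∼?_ : ∀ {p} (x y : 𝔽² p) → Dec (x ∼ y)
_∼?_ {p} (x₁ , x₂) (y₁ , y₂) = any? λ (c : Fin p) →
  ¬? (⌞ c ⌟ ≡? + 0 [𝔽 p ])
    ×-dec (⌞ c ⌟ ℤ.* ⌞ x₁ ⌟ ≡? ⌞ y₁ ⌟ [𝔽 p ])
    ×-dec (⌞ c ⌟ ℤ.* ⌞ x₂ ⌟ ≡? ⌞ y₂ ⌟ [𝔽 p ])

form : ℕ → ℤ → ℤ → ℤ → ℤ
form d μ x₁ x₂ =
  x₁ ℤ.^ d ℤ.+ x₂ ℤ.^ d ℤ.- + d ℤ.* μ ℤ.* x₁ ℤ.* x₂ ℤ.^ (d ∸ 1)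

OnHypersurface : ∀ {p} → ℕ → ℤ → 𝔽² p → Set
OnHypersurface {p} d μ (x₁ , x₂) = form d μ ⌞ x₁ ⌟ ⌞ x₂ ⌟ ≡ + 0 [𝔽 p ]

onHypersurface? : ∀ {p} d μ (x : 𝔽² p) → Dec (OnHypersurface d μ x)
onHypersurface? {p} d μ (x₁ , x₂) = form d μ ⌞ x₁ ⌟ ⌞ x₂ ⌟ ≡? + 0 [𝔽 p ]

-- The form is homogeneous, so its zero locus is a union of ∼-classes; keeping
-- one vector from each class counts the points of the hypersurface.
numberOfPoints : (p d : ℕ) → ℤ → ℕ
numberOfPoints p d μ =
  length (deduplicate _∼?_
    (filter (onHypersurface? d μ)
      (filter nonOrigin?
        (cartesianProduct (allFin p) (allFin p)))))

------------------------------------------------------------------------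
-- Rational arithmetic

infixr 8 _^_
_^_ : ℚ → ℕ → ℚ
_^_ = power +-*-rawSemiring

fromℤ : ℤ → ℚ
fromℤ n = n / 1

fromℕ : ℕ → ℚ
fromℕ n = fromℤ (+ n)

-- Inversion extended by 0 ⁻¹ = 0.  For d ≥ 2 and λ ≠ 0 it is only ever applied
-- to nonzero numbers below: the βₖ⁽ⁱ⁾ are positive, hence so are the (βₖ⁽ⁱ⁾)ₘ.
infix 9 _⁻¹
_⁻¹ : ℚ → ℚ
q ⁻¹ with q ≟ 0ℚ
... | yes _   = 0ℚ
... | no  q≢0 = 1/_ q {{≢-nonZero q≢0}}

infixl 7 _÷_
_÷_ : ℚ → ℚ → ℚ
x ÷ y = x * y ⁻¹

∑ : List ℕ → (ℕ → ℚ) → ℚ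
∑ ks f = foldr _+_ 0ℚ (map f ks)

∏ : List ℚ → (ℚ → ℚ) → ℚ
∏ xs f = foldr _*_ 1ℚ (map f xs)

-- Membership in ℤ₍ₚ₎; ↧ₙ is the denominator in lowest terms.
Localized : ℕ → ℚ → Set
Localized p q = Coprime p (↧ₙ q)

infix 4 _≡_[ℤ₍_₎]
_≡_[ℤ₍_₎] : ℚ → ℚ → ℕ → Set
x ≡ y [ℤ₍ p ₎] =
  Localized p x × Localized p y × ∃[ c ] Localized p c × x - y ≡ fromℕ p * c

------------------------------------------------------------------------
-- Hypergeometric series

pochhammer : ℚ → ℕ → ℚ
pochhammer x zero    = 1ℚ
pochhammer x (suc k) = pochhammer x k * (x + fromℕ k)

-- A power series is given by its sequence of coefficients.
hypergeometric : List ℚ → List ℚ → ℕ → ℚ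
hypergeometric αs βs k =
  ∏ αs (λ α → pochhammer α k) ÷ (∏ βs (λ β → pochhammer β k) * fromℕ (k !))

-- [ u ⟨ z ⟩]⟨ a , b ⟩ is the sum of uₖ zᵏ over all k ≥ 0 with a ≤ k ≤ b.  All
-- such k lie in the finite range 0, …, |⌊b⌋| that is filtered.
[_⟨_⟩]⟨_,_⟩ : (ℕ → ℚ) → ℚ → ℚ → ℚ → ℚ
[ u ⟨ z ⟩]⟨ a , b ⟩ =
  ∑ (filter (λ k → (a ≤? fromℕ k) ×-dec (fromℕ k ≤? b)) (upTo (suc ℤ.∣ floor b ∣)))
    (λ k → u k * z ^ k)

-- The multiples 1/n, 2/n, …, (n - 1)/n: the αₖ for n = d, the βₖ for n = d - 1.
fractions : ℕ → List ℚ
fractions n = map (λ j → fromℕ (suc j) ÷ fromℕ n) (upTo (n ∸ 1))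

incrementFirst : ℕ → List ℚ → List ℚ
incrementFirst i xs = map (_+ 1ℚ) (take i xs) ++ drop i xs

α⁽_⁾ : ℕ → ℕ → List ℚ
α⁽ i ⁾ d = incrementFirst i (fractions d)

β⁽_⁾ : ℕ → ℕ → List ℚ
β⁽ i ⁾ d = incrementFirst i (fractions (d ∸ 1))

{-# OPTIONS --safe #-}
module Submission where

open import Defs
open import Algebra.Bundles using (CommutativeRing)
open import Algebra.Definitions.RawSemiring using () renaming (_^_ to power; _×_ to multiple)
import Algebra.Properties.CommutativeSemiring.Binomial as Binomial
import Algebra.Properties.Semiring.Sum as SemiringSum
open import Data.Bool.Base using (if_then_else_)
open import Data.Fin.Base as Fin using (Fin; toℕ; fromℕ<)
open import Data.Fin.Properties as Fin using (toℕ<n; toℕ-fromℕ<; toℕ-injective)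
open import Data.Integer.Base as ℤ using (ℤ; +_; 0ℤ; 1ℤ; -1ℤ)
open import Data.Integer.Divisibility as ℤ using ()
open import Data.Integer.Divisibility.Signed as ℤ∣ using () renaming (_∣_ to _∣ₛ_)
import Data.Integer.DivMod as ℤ/
import Data.Integer.Properties as ℤ
open import Data.Integer.Tactic.RingSolver using (solve-∀)
open import Data.List.Base
  using (List; []; _∷_; _++_; map; filter; upTo; applyUpTo; deduplicate; length; tabulate; allFin; cartesianProduct)
import Data.List.Membership.Propositional.Properties as ∈
import Data.List.Membership.Propositional.Properties.WithK as ∈
import Data.List.Properties as List
open import Data.List.Membership.Propositional using (_∈_)
open import Data.List.Relation.Binary.BagAndSetEquality using (∼bag⇒↭)
open import Data.List.Relation.Binary.Permutation.Propositional.Properties using (↭-length)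
open import Data.List.Relation.Unary.All as All using (All; []; _∷_)
import Data.List.Relation.Unary.All.Properties as All
import Data.List.Relation.Unary.Unique.DecPropositional.Properties as DecUnique
import Data.List.Relation.Unary.Unique.Propositional.Properties as Unique
open import Data.Nat.Base as ℕ using (ℕ; zero; suc; 2+; _∸_; _!; _≤_; _<_; z≤n; s≤s; z<s; s<s)
open import Data.Nat.Combinatorics
  using (_C_; nCk≡n!/k![n-k]!; k![n∸k]!∣n!; k>n⇒nCk≡0; nCk≡nC[n∸k]; nCk+nC[k+1]≡[n+1]C[k+1]; nCn≡1; nC1≡n)
import Data.Nat.Coprimality as Coprimality
open import Data.Nat.Divisibility as ℕ∣ using (_∣_; _∤_; divides)
import Data.Nat.DivMod as ℕ
open import Data.Nat.Induction using (<-rec)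
open import Data.Nat.Primality using (Prime; euclidsLemma; prime⇒irreducible; ¬prime[0]; ¬prime[1])
import Data.Nat.Properties as ℕ
import Data.Nat.Tactic.RingSolver as ℕSolver
open import Data.Product.Base using (_×_; _,_; proj₁; proj₂)
open import Data.Rational.Base as ℚ using (ℚ; mkℚ; 0ℚ; 1ℚ; _+_; _*_; _-_; ↥_; ↧_; floor)
import Data.Rational.Properties as ℚ
open import Data.Rational.Solver using (module +-*-Solver)
import Data.Rational.Unnormalised.Base as ℚᵘ
open import Data.Sum.Base using (_⊎_; inj₁; inj₂; [_,_]′)
open import Function.Base using (_∘_; id)
open import Function.Bundles using (_⇔_; mk⇔; Equivalence)
open import Level using (0ℓ)
open import Relation.Binary.Definitions as B using (DecidableEquality)
open import Relation.Binary.PropositionalEquality hiding (setoid)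
import Relation.Binary.Reasoning.Setoid as SetoidReasoning
open import Relation.Nullary.Decidable.Core using (Dec; yes; no; does; ¬?; _×-dec_)
open import Relation.Nullary.Decidable using (dec-true; dec-false)
open import Relation.Nullary.Negation.Core using (¬_; contradiction)
open import Relation.Unary using (Decidable)

-- Counting roots t of tᵈ + 1 - dμt by Fermat, N(μ) ≡ ∑ₜ (1 - (tᵈ + 1 - dμt)ᵖ⁻¹) mod p.  Expand by
-- the binomial theorem twice: N(0) cancels the terms in which the monomial t does not occur, and
-- since C(p-1, b) ≡ (-1)ᵇ and the power sums ∑ₜ tⁿ (n > 0) are -1 or 0 according as p - 1 ∣ n or not,
--
--   N(λ) - N(0) ≡ ∑_{k < p} C(r, k) (dλ)ᵖ⁻¹⁻ʳ,   where r = dk mod (p - 1).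
--
-- The k-th term of the i-th series is exactly C(dk + i, k) (dλ)⁻ᵈᵏ.  If k lies in the i-th range then
-- dk = r + i(p - 1), so dk + i = r + ip and the two terms agree mod p, because C(n, k) has period p
-- in n for k < p.  The k that lie in no range are those with r < k, for which C(r, k) = 0.

open SemiringSum (CommutativeRing.semiring ℤ.+-*-commutativeRing) using (sum; sum-cong-≗)
open +-*-Solver using (solve; _:=_; _:*_; _:+_; :-_; _:-_)

-- Congruences and sums modulo p

-- A term of a series cannot be reduced mod p factor by factor. For i ≥ 1 and k in the i-th range,
-- (d-1)k + i ≥ ip, so p divides ((d-1)k + i)!, which up to units mod p is the product of the
-- Pochhammer symbols in the denominator. The term is therefore evaluated exactly in ℚ: the
-- multiplication formula for Pochhammer symbols turns numerator and denominator into (dk + i)! and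
-- ((d-1)k + i)!, up to k!, powers of d and d-1 and a common i!. The constant in the argument of the
-- series cancels the powers of d-1, and what is reduced is an integer over a power of dλ, a unit
-- mod p. The two bounds of a range have separate origins. Given dk = r + i(p - 1), the lower bound
-- i(p - 1) ≤ (d-1)k says k ≤ r, and the upper bound says dk < (i+1)(p - 1). Shifting the first i
-- parameters by 1 supplies the summand i that completes i(p - 1) to ip.

Σ : ℕ → (ℕ → ℤ) → ℤ
Σ n f = sum {n} (f ∘ toℕ)

nCk*k![n∸k]!≡n! : ∀ {n k} → k ≤ n → (n C k) ℕ.* (k ! ℕ.* (n ∸ k) !) ≡ n !
nCk*k![n∸k]!≡n! {n} {k} k≤n = trans (cong (ℕ._* (k ! ℕ.* (n ∸ k) !)) (nCk≡n!/k![n-k]! k≤n)) (ℕ.m/n*n≡m (k![n∸k]!∣n! k≤n))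
  where instance _ = k ℕ.!* (n ∸ k) !≢0

binomialTheorem : ∀ x y n →
  (x ℤ.+ y) ℤ.^ n ≡ Σ (suc n) (λ k → + (n C k) ℤ.* (x ℤ.^ k ℤ.* y ℤ.^ (n ∸ k)))
binomialTheorem x y n = trans (sym (power≡^ (x ℤ.+ y) n))
  (trans (Binomial.theorem (CommutativeRing.commutativeSemiring ℤ.+-*-commutativeRing) n x y)
    (sum-cong-≗ {suc n} λ k → trans (multiple≡* (n C toℕ k) _)
      (cong (+ (n C toℕ k) ℤ.*_) (cong₂ ℤ._*_ (power≡^ x (toℕ k)) (power≡^ y (n ∸ toℕ k))))))
  where
  power≡^ : ∀ a k → power ℤ.+-*-rawSemiring a k ≡ a ℤ.^ k
  power≡^ a zero    = refl
  power≡^ a (suc k) = cong (a ℤ.*_) (power≡^ a k)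
  multiple≡* : ∀ k a → multiple ℤ.+-*-rawSemiring k a ≡ + k ℤ.* a
  multiple≡* zero    a = sym (ℤ.*-zeroˡ a)
  multiple≡* (suc k) a = trans (cong (ℤ._+_ a) (multiple≡* k a)) (sym (ℤ.suc-* (+ k) a))

module ModularArithmetic (p : ℕ) where

  infix 4 _≈_
  -- A record, because the divisibility of a difference does not determine its two terms; with the
  -- record both sides of a congruence can be recovered from its type.
  record _≈_ (a b : ℤ) : Set where
    constructor modulo
    field p∣a-b : + p ∣ₛ a ℤ.- b

  private
    ∣-cast : ∀ {a b} → a ≡ b → + p ∣ₛ a → + p ∣ₛ b
    ∣-cast = subst (+ p ∣ₛ_)

  ℤ/p : CommutativeRing 0ℓ 0ℓ
  ℤ/p = record
    { _≈_ = _≈_ ; _+_ = ℤ._+_ ; _*_ = ℤ._*_ ; -_ = ℤ.-_ ; 0# = 0ℤ ; 1# = 1ℤ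
    ; isCommutativeRing = record
      { isRing = record
        { +-isAbelianGroup = record
          { isGroup = record
            { isMonoid = record
              { isSemigroup = record
                { isMagma = record
                  { isEquivalence = record { refl = reflexive refl ; sym = ≈-sym ; trans = ≈-trans }
                  ; ∙-cong = +-cong }
                ; assoc = λ a b c → reflexive (ℤ.+-assoc a b c) }
              ; identity = reflexive ∘ ℤ.+-identityˡ , reflexive ∘ ℤ.+-identityʳ }
            ; inverse = reflexive ∘ ℤ.+-inverseˡ , reflexive ∘ ℤ.+-inverseʳ
            ; ⁻¹-cong = neg-cong }
          ; comm = λ a b → reflexive (ℤ.+-comm a b) }
        ; *-cong = *-cong
        ; *-assoc = λ a b c → reflexive (ℤ.*-assoc a b c)
        ; *-identity = reflexive ∘ ℤ.*-identityˡ , reflexive ∘ ℤ.*-identityʳ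
        ; distrib = (λ a b c → reflexive (ℤ.*-distribˡ-+ a b c)) , (λ a b c → reflexive (ℤ.*-distribʳ-+ a b c)) }
      ; *-comm = λ a b → reflexive (ℤ.*-comm a b) } }
    where
    reflexive : ∀ {a b} → a ≡ b → a ≈ b
    reflexive {a} refl = modulo (ℤ∣.divides 0ℤ (trans (ℤ.+-inverseʳ a) (sym (ℤ.*-zeroˡ (+ p)))))
    ≈-sym : ∀ {a b} → a ≈ b → b ≈ a
    ≈-sym {a} {b} (modulo h) = modulo (∣-cast (eq a b) (ℤ∣.∣m⇒∣-m h))
      where eq : ∀ a b → ℤ.- (a ℤ.- b) ≡ b ℤ.- a
            eq = solve-∀
    ≈-trans : ∀ {a b c} → a ≈ b → b ≈ c → a ≈ c
    ≈-trans {a} {b} {c} (modulo h) (modulo k) = modulo (∣-cast (eq a b c) (ℤ∣.∣m∣n⇒∣m+n h k))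
      where eq : ∀ a b c → (a ℤ.- b) ℤ.+ (b ℤ.- c) ≡ a ℤ.- c
            eq = solve-∀
    +-cong : ∀ {a b c d} → a ≈ b → c ≈ d → a ℤ.+ c ≈ b ℤ.+ d
    +-cong {a} {b} {c} {d} (modulo h) (modulo k) = modulo (∣-cast (eq a b c d) (ℤ∣.∣m∣n⇒∣m+n h k))
      where eq : ∀ a b c d → (a ℤ.- b) ℤ.+ (c ℤ.- d) ≡ (a ℤ.+ c) ℤ.- (b ℤ.+ d)
            eq = solve-∀
    *-cong : ∀ {a b c d} → a ≈ b → c ≈ d → a ℤ.* c ≈ b ℤ.* d
    *-cong {a} {b} {c} {d} (modulo h) (modulo k) =
      modulo (∣-cast (eq a b c d) (ℤ∣.∣m∣n⇒∣m+n (ℤ∣.∣n⇒∣m*n c h) (ℤ∣.∣n⇒∣m*n b k)))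
      where eq : ∀ a b c d → c ℤ.* (a ℤ.- b) ℤ.+ b ℤ.* (c ℤ.- d) ≡ a ℤ.* c ℤ.- b ℤ.* d
            eq = solve-∀
    neg-cong : ∀ {a b} → a ≈ b → ℤ.- a ≈ ℤ.- b
    neg-cong {a} {b} (modulo h) = modulo (∣-cast (eq a b) (ℤ∣.∣m⇒∣-m h))
      where eq : ∀ a b → ℤ.- (a ℤ.- b) ≡ ℤ.- a ℤ.- ℤ.- b
            eq = solve-∀

  open CommutativeRing ℤ/p public
    using (reflexive; +-cong; *-cong; -‿cong; setoid)
    renaming (refl to ≈-refl; sym to ≈-sym; trans to ≈-trans)
  module ΣP = SemiringSum (CommutativeRing.semiring ℤ/p)
  module ≈-Reasoning = SetoidReasoning setoid

  +-congˡ : ∀ a {b c} → b ≈ c → a ℤ.+ b ≈ a ℤ.+ c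
  +-congˡ a = +-cong (≈-refl {a})

  *-congˡ : ∀ a {b c} → b ≈ c → a ℤ.* b ≈ a ℤ.* c
  *-congˡ a = *-cong (≈-refl {a})

  *-congʳ : ∀ c {a b} → a ≈ b → a ℤ.* c ≈ b ℤ.* c
  *-congʳ c h = *-cong h (≈-refl {c})

  ∣⇒≈0 : ∀ {a} → p ∣ ℤ.∣ a ∣ → a ≈ 0ℤ
  ∣⇒≈0 {a} h = modulo (∣-cast (sym (ℤ.+-identityʳ a)) (ℤ∣.∣ᵤ⇒∣ h))

  ≈0⇒∣ : ∀ {a} → a ≈ 0ℤ → p ∣ ℤ.∣ a ∣
  ≈0⇒∣ {a} (modulo h) = ℤ∣.∣⇒∣ᵤ (∣-cast (ℤ.+-identityʳ a) h)

  -≈0⇒≈ : ∀ {a b} → a ℤ.- b ≈ 0ℤ → a ≈ b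
  -≈0⇒≈ h = modulo (ℤ∣.∣ᵤ⇒∣ (≈0⇒∣ h))

  ≈⇒-≈0 : ∀ {a b} → a ≈ b → a ℤ.- b ≈ 0ℤ
  ≈⇒-≈0 (modulo h) = ∣⇒≈0 (ℤ∣.∣⇒∣ᵤ h)

  p≈0 : + p ≈ 0ℤ
  p≈0 = ∣⇒≈0 ℕ∣.∣-refl

  ^-cong : ∀ {a b} n → a ≈ b → a ℤ.^ n ≈ b ℤ.^ n
  ^-cong zero    h = ≈-refl
  ^-cong (suc n) h = *-cong h (^-cong n h)

  *-zero-congˡ : ∀ {a} b → a ≈ 0ℤ → a ℤ.* b ≈ 0ℤ
  *-zero-congˡ b h = ≈-trans (*-congʳ b h) (reflexive (ℤ.*-zeroˡ b))

  *-zero-congʳ : ∀ a {b} → b ≈ 0ℤ → a ℤ.* b ≈ 0ℤ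
  *-zero-congʳ a h = ≈-trans (*-congˡ a h) (reflexive (ℤ.*-zeroʳ a))

  Σ-cong : ∀ n {f g} → (∀ i → i < n → f i ≈ g i) → Σ n f ≈ Σ n g
  Σ-cong n h = ΣP.sum-cong-≋ {n} λ i → h (toℕ i) (toℕ<n i)

  Σ-zero : ∀ n {f} → (∀ i → i < n → f i ≈ 0ℤ) → Σ n f ≈ 0ℤ
  Σ-zero n h = ≈-trans (Σ-cong n h) (ΣP.sum-replicate-zero n)

  Σ-last : ∀ n f → Σ (suc n) f ≈ Σ n f ℤ.+ f n
  Σ-last zero    f = reflexive (ℤ.+-comm (f 0) 0ℤ)
  Σ-last (suc n) f = ≈-trans (+-congˡ (f 0) (Σ-last n (f ∘ suc))) (reflexive (sym (ℤ.+-assoc (f 0) _ _)))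

  Σ-extend : ∀ {m n} → m ≤ n → ∀ f → (∀ i → m ≤ i → i < n → f i ≈ 0ℤ) → Σ n f ≈ Σ m f
  Σ-extend {n = n} z≤n       f h = Σ-zero n (λ i → h i z≤n)
  Σ-extend         (s≤s m≤n) f h = +-congˡ (f 0) (Σ-extend m≤n (f ∘ suc) (λ i m≤i i<n → h (suc i) (s≤s m≤i) (s<s i<n)))

  Σ-single : ∀ {n j} → j < n → ∀ f → (∀ i → i < n → i ≢ j → f i ≈ 0ℤ) → Σ n f ≈ f j
  Σ-single {suc n} {zero}  _         f h =
    ≈-trans (+-congˡ (f 0) (Σ-zero n (λ i i<n → h (suc i) (s<s i<n) λ ()))) (reflexive (ℤ.+-identityʳ _))
  Σ-single {suc n} {suc j} (s≤s j<n) f h =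
    ≈-trans (+-cong (h 0 z<s λ ()) (Σ-single j<n (f ∘ suc) λ i i<n i≢j → h (suc i) (s<s i<n) (i≢j ∘ ℕ.suc-injective)))
            (reflexive (ℤ.+-identityˡ _))

  Σ-+ : ∀ n f g → Σ n (λ i → f i ℤ.+ g i) ≈ Σ n f ℤ.+ Σ n g
  Σ-+ n f g = ΣP.∑-distrib-+ {n} (f ∘ toℕ) (g ∘ toℕ)

  Σ-*ˡ : ∀ n a f → a ℤ.* Σ n f ≈ Σ n (λ i → a ℤ.* f i)
  Σ-*ˡ n a f = ΣP.*-distribˡ-sum {n} a (f ∘ toℕ)

  Σ-comm : ∀ m n (f : ℕ → ℕ → ℤ) → Σ m (λ i → Σ n (f i)) ≈ Σ n (λ j → Σ m (λ i → f i j))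
  Σ-comm m n f = ΣP.∑-comm {m} {n} λ i j → f (toℕ i) (toℕ j)

-- The field with p elements

module PrimeField {m : ℕ} (prime : Prime (2+ m)) where

  p = 2+ m
  open ModularArithmetic p

  euclid : ∀ {a b} → a ℤ.* b ≈ 0ℤ → a ≈ 0ℤ ⊎ b ≈ 0ℤ
  euclid {a} {b} h with euclidsLemma ℤ.∣ a ∣ ℤ.∣ b ∣ prime (subst (p ∣_) (ℤ.abs-* a b) (≈0⇒∣ h))
  ... | inj₁ p∣a = inj₁ (∣⇒≈0 p∣a)
  ... | inj₂ p∣b = inj₂ (∣⇒≈0 p∣b)

  *-cancelˡ : ∀ a {b c} → ¬ a ≈ 0ℤ → a ℤ.* b ≈ a ℤ.* c → b ≈ c
  *-cancelˡ a {b} {c} a≉0 h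
    with euclid {a} {b ℤ.- c} (≈-trans (reflexive (eq a b c)) (≈⇒-≈0 h))
    where eq : ∀ a b c → a ℤ.* (b ℤ.- c) ≡ a ℤ.* b ℤ.- a ℤ.* c
          eq = solve-∀
  ... | inj₁ a≈0   = contradiction a≈0 a≉0
  ... | inj₂ b-c≈0 = -≈0⇒≈ b-c≈0

  <p⇒≉0 : ∀ {a} → 0 < a → a < p → ¬ + a ≈ 0ℤ
  <p⇒≉0 {suc a} _ a<p h = ℕ∣.>⇒∤ a<p (≈0⇒∣ h)

  1≉0 : ¬ 1ℤ ≈ 0ℤ
  1≉0 = <p⇒≉0 z<s (s<s z<s)

  ^-≉0 : ∀ {a} n → ¬ a ≈ 0ℤ → ¬ a ℤ.^ n ≈ 0ℤ
  ^-≉0 zero    a≉0 h = 1≉0 h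
  ^-≉0 {a} (suc n) a≉0 h = [ a≉0 , ^-≉0 n a≉0 ]′ (euclid {a} h)

  !≉0 : ∀ {k} → k < p → ¬ + (k !) ≈ 0ℤ
  !≉0 {zero}  _   h = 1≉0 h
  !≉0 {suc k} k<p h =
    [ <p⇒≉0 z<s k<p , !≉0 (ℕ.<-trans (ℕ.n<1+n k) k<p) ]′
      (euclid {+ suc k} (≈-trans (reflexive (sym (ℤ.pos-* (suc k) (k !)))) h))

  -- In C(p, k) k! (p-k)! = p! the prime divides the right side and neither factorial on the left.
  pCk≈0 : ∀ {k} → 0 < k → k < p → + (p C k) ≈ 0ℤ
  pCk≈0 {suc k} _ k<p
    with euclid {+ (p C suc k)} (≈-trans (reflexive (trans (sym (ℤ.pos-* (p C suc k) d)) (cong +_ (nCk*k![n∸k]!≡n! (ℕ.<⇒≤ k<p))))) p!≈0)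
    where
    d = suc k ! ℕ.* (p ∸ suc k) !
    p!≈0 : + (p !) ≈ 0ℤ
    p!≈0 = ∣⇒≈0 (ℕ∣.m∣m*n (suc m !))
  ... | inj₁ h = h
  ... | inj₂ h with euclid {+ (suc k !)} (≈-trans (reflexive (sym (ℤ.pos-* (suc k !) _))) h)
  ...   | inj₁ h₁ = contradiction h₁ (!≉0 k<p)
  ...   | inj₂ h₂ = contradiction h₂ (!≉0 (s≤s (ℕ.m∸n≤m (suc m) k)))

  pascal : ∀ n k → + (n C k) ℤ.+ + (n C suc k) ≡ + (suc n C suc k)
  pascal n k = trans (sym (ℤ.pos-+ (n C k) _)) (cong +_ (nCk+nC[k+1]≡[n+1]C[k+1] n k))

  -- By Pascal's rule neighbouring entries of row p - 1 add up to an inner entry of row p, which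
  -- vanishes; so the signs alternate, starting from 1.
  [p-1]Ck≈±1 : ∀ {k} → k < p → + (suc m C k) ≈ -1ℤ ℤ.^ k
  [p-1]Ck≈±1 {zero}  _   = ≈-refl
  [p-1]Ck≈±1 {suc k} k<p = begin
    + (suc m C suc k)                     ≡⟨ eq (+ (suc m C k)) _ ⟩
    + (suc m C k) ℤ.+ + (suc m C suc k) ℤ.- + (suc m C k) ≡⟨ cong (ℤ._- + (suc m C k)) (pascal (suc m) k) ⟩
    + (p C suc k) ℤ.- + (suc m C k)       ≈⟨ +-cong (pCk≈0 z<s k<p) (-‿cong ([p-1]Ck≈±1 (ℕ.<-trans (ℕ.n<1+n k) k<p))) ⟩
    0ℤ ℤ.- -1ℤ ℤ.^ k                      ≡⟨ eq′ (-1ℤ ℤ.^ k) ⟩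
    -1ℤ ℤ.* -1ℤ ℤ.^ k                     ∎
    where
    open ≈-Reasoning
    eq : ∀ a b → b ≡ a ℤ.+ b ℤ.- a
    eq = solve-∀
    eq′ : ∀ a → 0ℤ ℤ.- a ≡ -1ℤ ℤ.* a
    eq′ = solve-∀

  -- For n = 0 this is the vanishing of the inner entries of row p, where k < p matters; Pascal's
  -- rule carries it to every n.
  C-periodic : ∀ n {k} → k < p → + ((n ℕ.+ p) C k) ≈ + (n C k)
  C-periodic n       {zero}  _   = ≈-refl
  C-periodic zero    {suc k} k<p = pCk≈0 z<s k<p
  C-periodic (suc n) {suc k} k<p = begin
    + (suc (n ℕ.+ p) C suc k)                        ≡⟨ pascal (n ℕ.+ p) k ⟨
    + ((n ℕ.+ p) C k) ℤ.+ + ((n ℕ.+ p) C suc k)      ≈⟨ +-cong (C-periodic n (ℕ.<-trans (ℕ.n<1+n k) k<p)) (C-periodic n k<p) ⟩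
    + (n C k) ℤ.+ + (n C suc k)                      ≡⟨ pascal n k ⟩
    + (suc n C suc k)                                ∎
    where open ≈-Reasoning

  C-periodic-* : ∀ n i {k} → k < p → + ((n ℕ.+ i ℕ.* p) C k) ≈ + (n C k)
  C-periodic-* n zero    {k} k<p = reflexive (cong (λ x → + (x C k)) (ℕ.+-identityʳ n))
  C-periodic-* n (suc i) {k} k<p = begin
    + ((n ℕ.+ (p ℕ.+ i ℕ.* p)) C k) ≡⟨ cong (λ x → + (x C k)) (trans (cong (n ℕ.+_) (ℕ.+-comm p (i ℕ.* p))) (sym (ℕ.+-assoc n (i ℕ.* p) p))) ⟩
    + ((n ℕ.+ i ℕ.* p ℕ.+ p) C k)   ≈⟨ C-periodic (n ℕ.+ i ℕ.* p) k<p ⟩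
    + ((n ℕ.+ i ℕ.* p) C k)         ≈⟨ C-periodic-* n i k<p ⟩
    + (n C k)                       ∎
    where open ≈-Reasoning

  -- Induction on `a`: only the two outer terms of the expansion of (a + 1)ᵖ survive.
  fermat : ∀ a → (+ a) ℤ.^ p ≈ + a
  fermat zero    = ≈-refl
  fermat (suc a) = begin
    (1ℤ ℤ.+ + a) ℤ.^ p                                  ≡⟨ cong (ℤ._^ p) (ℤ.+-comm 1ℤ (+ a)) ⟩
    (+ a ℤ.+ 1ℤ) ℤ.^ p                                  ≡⟨ binomialTheorem (+ a) 1ℤ p ⟩
    f 0 ℤ.+ Σ p (f ∘ suc)                               ≈⟨ +-cong (reflexive f0≡1) (Σ-last (suc m) (f ∘ suc)) ⟩
    1ℤ ℤ.+ (Σ (suc m) (f ∘ suc) ℤ.+ f p)                ≈⟨ +-congˡ 1ℤ (+-cong (Σ-zero (suc m) middle) (reflexive fp≡aᵖ)) ⟩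
    1ℤ ℤ.+ (0ℤ ℤ.+ (+ a) ℤ.^ p)                         ≡⟨ cong (ℤ._+_ 1ℤ) (ℤ.+-identityˡ ((+ a) ℤ.^ p)) ⟩
    1ℤ ℤ.+ (+ a) ℤ.^ p                                  ≈⟨ +-congˡ 1ℤ (fermat a) ⟩
    1ℤ ℤ.+ + a                                          ∎
    where
    open ≈-Reasoning
    f : ℕ → ℤ
    f k = + (p C k) ℤ.* ((+ a) ℤ.^ k ℤ.* 1ℤ ℤ.^ (p ∸ k))
    f0≡1 : f 0 ≡ 1ℤ
    f0≡1 = trans (ℤ.*-identityˡ _) (trans (ℤ.*-identityˡ _) (ℤ.^-zeroˡ p))
    fp≡aᵖ : f p ≡ (+ a) ℤ.^ p
    fp≡aᵖ = trans (cong₂ (λ c d → + c ℤ.* ((+ a) ℤ.^ p ℤ.* 1ℤ ℤ.^ d)) (nCn≡1 p) (ℕ.n∸n≡0 p))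
      (trans (ℤ.*-identityˡ _) (ℤ.*-identityʳ _))
    middle : ∀ k → k < suc m → f (suc k) ≈ 0ℤ
    middle k k<p = *-zero-congˡ _ (pCk≈0 z<s (s<s k<p))

  residue : ∀ a → a ≈ + (a ℤ/.%ℕ p)
  residue a = -≈0⇒≈ (≈-trans (reflexive (trans (cong (ℤ._- r) (ℤ/.a≡a%ℕn+[a/ℕn]*n a p)) (eq r (a ℤ/./ℕ p ℤ.* + p))))
    (*-zero-congʳ (a ℤ/./ℕ p) p≈0))
    where
    r = + (a ℤ/.%ℕ p)
    eq : ∀ r x → r ℤ.+ x ℤ.- r ≡ x
    eq = solve-∀

  fermat-ℤ : ∀ a → a ℤ.^ p ≈ a
  fermat-ℤ a = ≈-trans (^-cong p (residue a)) (≈-trans (fermat (a ℤ/.%ℕ p)) (≈-sym (residue a)))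

  fermat-unit : ∀ a → ¬ a ≈ 0ℤ → a ℤ.^ suc m ≈ 1ℤ
  fermat-unit a a≉0 = *-cancelˡ a a≉0 (≈-trans (fermat-ℤ a) (reflexive (sym (ℤ.*-identityʳ a))))

  fermat-unit-* : ∀ a i → ¬ a ≈ 0ℤ → a ℤ.^ (i ℕ.* suc m) ≈ 1ℤ
  fermat-unit-* a i a≉0 = begin
    a ℤ.^ (i ℕ.* suc m)   ≡⟨ cong (a ℤ.^_) (ℕ.*-comm i (suc m)) ⟩
    a ℤ.^ (suc m ℕ.* i)   ≡⟨ ℤ.^-*-assoc a (suc m) i ⟨
    (a ℤ.^ suc m) ℤ.^ i   ≈⟨ ^-cong i (fermat-unit a a≉0) ⟩
    1ℤ ℤ.^ i              ≡⟨ ℤ.^-zeroˡ i ⟩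
    1ℤ                    ∎
    where open ≈-Reasoning

  -- The exponent is kept positive so that `a ≈ 0` is covered too: 0⁰ = 1 but 0ᵖ⁻¹ = 0. For the same
  -- reason the proof rests on aᵖ ≈ a and not on aᵖ⁻¹ ≈ 1.
  ^-periodic : ∀ a r i → a ℤ.^ (suc r ℕ.+ i ℕ.* suc m) ≈ a ℤ.^ suc r
  ^-periodic a r zero    = reflexive (cong (a ℤ.^_) (ℕ.+-identityʳ (suc r)))
  ^-periodic a r (suc i) = begin
    a ℤ.^ (suc r ℕ.+ (suc m ℕ.+ i ℕ.* suc m))   ≡⟨ cong (a ℤ.^_) (shuffle r m (i ℕ.* suc m)) ⟩
    a ℤ.^ ((r ℕ.+ i ℕ.* suc m) ℕ.+ p)           ≡⟨ ℤ.^-distribˡ-+-* a (r ℕ.+ i ℕ.* suc m) p ⟩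
    a ℤ.^ (r ℕ.+ i ℕ.* suc m) ℤ.* a ℤ.^ p       ≈⟨ *-congˡ (a ℤ.^ (r ℕ.+ i ℕ.* suc m)) (fermat-ℤ a) ⟩
    a ℤ.^ (r ℕ.+ i ℕ.* suc m) ℤ.* a             ≡⟨ ℤ.*-comm _ a ⟩
    a ℤ.^ (suc r ℕ.+ i ℕ.* suc m)               ≈⟨ ^-periodic a r i ⟩
    a ℤ.^ suc r                                 ∎
    where
    open ≈-Reasoning
    shuffle : ∀ r m x → suc r ℕ.+ (suc m ℕ.+ x) ≡ (r ℕ.+ x) ℕ.+ 2+ m
    shuffle = ℕSolver.solve-∀

  -- Power sums over the field

  powerSum : ℕ → ℤ
  powerSum n = Σ p (λ t → (+ t) ℤ.^ n)

  -- Telescoping (t + 1)ⁿ⁺¹ - tⁿ⁺¹ over t and expanding gives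
  -- ∑_{k ≤ n} C(n+1, k) powerSum k ≈ 0, which determines powerSum n while n + 1 < p.
  powerSum≈0 : ∀ n → n < suc m → powerSum n ≈ 0ℤ
  powerSum≈0 = <-rec (λ n → n < suc m → powerSum n ≈ 0ℤ) step
    where
    step : ∀ n → (∀ {k} → k < n → k < suc m → powerSum k ≈ 0ℤ) → n < suc m → powerSum n ≈ 0ℤ
    step n rec n<p-1 = [ (λ h → contradiction h (<p⇒≉0 z<s (s<s n<p-1))) , id ]′
      (euclid {+ suc n} (begin
        + suc n ℤ.* powerSum n                        ≡⟨ cong (λ c → + c ℤ.* powerSum n) 1+nCn≡1+n ⟨
        + (suc n C n) ℤ.* powerSum n                  ≡⟨ ℤ.+-identityˡ _ ⟨
        0ℤ ℤ.+ + (suc n C n) ℤ.* powerSum n           ≈⟨ +-cong (Σ-zero n λ k k<n → *-zero-congʳ (+ (suc n C k)) (rec k<n (ℕ.<-trans k<n n<p-1))) ≈-refl ⟨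
        Σ n c ℤ.+ c n                                 ≈⟨ Σ-last n c ⟨
        Σ (suc n) c                                   ≡⟨ eq (Σ (suc n) c) (c (suc n)) ⟩
        Σ (suc n) c ℤ.+ c (suc n) ℤ.- c (suc n)       ≈⟨ +-cong expansion (-‿cong c-top) ⟩
        powerSum (suc n) ℤ.- powerSum (suc n)         ≡⟨ ℤ.+-inverseʳ (powerSum (suc n)) ⟩
        0ℤ                                            ∎))
      where
      open ≈-Reasoning
      c : ℕ → ℤ
      c k = + (suc n C k) ℤ.* powerSum k
      eq : ∀ a b → a ≡ a ℤ.+ b ℤ.- b
      eq = solve-∀
      1+nCn≡1+n : suc n C n ≡ suc n
      1+nCn≡1+n = trans (nCk≡nC[n∸k] (ℕ.n≤1+n n)) (trans (cong (suc n C_) (ℕ.m+n∸n≡m 1 n)) (nC1≡n (suc n)))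
      c-top : c (suc n) ≈ powerSum (suc n)
      c-top = reflexive (trans (cong (λ x → + x ℤ.* powerSum (suc n)) (nCn≡1 (suc n))) (ℤ.*-identityˡ _))
      g : ℕ → ℤ
      g t = (+ t) ℤ.^ suc n
      -- Shifting t by one loses 0ⁿ⁺¹ = 0 and gains pⁿ⁺¹ ≈ 0.
      shift : Σ p (g ∘ suc) ≈ powerSum (suc n)
      shift = begin
        Σ p (g ∘ suc)           ≡⟨ ℤ.+-identityˡ _ ⟨
        g 0 ℤ.+ Σ p (g ∘ suc)   ≈⟨ Σ-last p g ⟩
        Σ p g ℤ.+ g p           ≈⟨ +-congˡ (Σ p g) (*-zero-congˡ ((+ p) ℤ.^ n) p≈0) ⟩
        Σ p g ℤ.+ 0ℤ            ≡⟨ ℤ.+-identityʳ _ ⟩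
        Σ p g                   ∎
      term : ∀ t → g (suc t) ≈ Σ (2+ n) (λ k → + (suc n C k) ℤ.* (+ t) ℤ.^ k)
      term t = begin
        (1ℤ ℤ.+ + t) ℤ.^ suc n  ≡⟨ cong (ℤ._^ suc n) (ℤ.+-comm 1ℤ (+ t)) ⟩
        (+ t ℤ.+ 1ℤ) ℤ.^ suc n  ≡⟨ binomialTheorem (+ t) 1ℤ (suc n) ⟩
        Σ (2+ n) (λ k → + (suc n C k) ℤ.* ((+ t) ℤ.^ k ℤ.* 1ℤ ℤ.^ (suc n ∸ k)))
          ≈⟨ Σ-cong (2+ n) {g = λ k → + (suc n C k) ℤ.* (+ t) ℤ.^ k} (λ k _ → reflexive (cong (+ (suc n C k) ℤ.*_)
               (trans (cong ((+ t) ℤ.^ k ℤ.*_) (ℤ.^-zeroˡ (suc n ∸ k))) (ℤ.*-identityʳ ((+ t) ℤ.^ k))))) ⟩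
        Σ (2+ n) (λ k → + (suc n C k) ℤ.* (+ t) ℤ.^ k) ∎
      expansion : Σ (suc n) c ℤ.+ c (suc n) ≈ powerSum (suc n)
      expansion = begin
        Σ (suc n) c ℤ.+ c (suc n)  ≈⟨ Σ-last (suc n) c ⟨
        Σ (2+ n) c                 ≈⟨ Σ-cong (2+ n) (λ k _ → Σ-*ˡ p (+ (suc n C k)) (λ t → (+ t) ℤ.^ k)) ⟩
        Σ (2+ n) (λ k → Σ p (λ t → + (suc n C k) ℤ.* (+ t) ℤ.^ k))
          ≈⟨ Σ-comm (2+ n) p (λ k t → + (suc n C k) ℤ.* (+ t) ℤ.^ k) ⟩
        Σ p (λ t → Σ (2+ n) (λ k → + (suc n C k) ℤ.* (+ t) ℤ.^ k)) ≈⟨ Σ-cong p (λ t _ → term t) ⟨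
        Σ p (g ∘ suc)              ≈⟨ shift ⟩
        powerSum (suc n)           ∎

  -- The term at t = 0 vanishes, and each of the other p - 1 terms is 1 by Fermat.
  powerSum[p-1]≈-1 : powerSum (suc m) ≈ -1ℤ
  powerSum[p-1]≈-1 = begin
    0ℤ ℤ.+ Σ (suc m) (λ t → (+ suc t) ℤ.^ suc m) ≡⟨ ℤ.+-identityˡ _ ⟩
    Σ (suc m) (λ t → (+ suc t) ℤ.^ suc m)        ≈⟨ Σ-cong (suc m) (λ t t<p-1 → fermat-unit (+ suc t) (<p⇒≉0 z<s (s<s t<p-1))) ⟩
    Σ (suc m) (λ _ → 1ℤ)                         ≡⟨ Σ-const (suc m) ⟩
    + suc m                                      ≡⟨ eq (+ suc m) ⟩
    (1ℤ ℤ.+ + suc m) ℤ.- 1ℤ                      ≈⟨ +-cong p≈0 (≈-refl {ℤ.- 1ℤ}) ⟩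
    -1ℤ                                          ∎
    where
    open ≈-Reasoning
    eq : ∀ a → a ≡ (1ℤ ℤ.+ a) ℤ.- 1ℤ
    eq = solve-∀
    Σ-const : ∀ n → Σ n (λ _ → 1ℤ) ≡ + n
    Σ-const zero    = refl
    Σ-const (suc n) = cong (ℤ._+_ 1ℤ) (Σ-const n)

  -- The exponent is written as a successor because exponent 0 is an exception: with 0⁰ = 1 that sum
  -- is p ≈ 0, although p - 1 divides 0.
  powerSum-∣ : ∀ n → suc m ∣ suc n → powerSum (suc n) ≈ -1ℤ
  powerSum-∣ n (divides zero    ())
  powerSum-∣ n (divides (suc i) eq) = ≈-trans
    (Σ-cong p λ t _ → ≈-trans (reflexive (cong ((+ t) ℤ.^_) eq)) (^-periodic (+ t) m i))
    powerSum[p-1]≈-1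

  powerSum-∤ : ∀ n → suc m ∤ n → powerSum n ≈ 0ℤ
  powerSum-∤ n ∤ with n ℕ.% suc m in eq
  ... | zero  = contradiction (ℕ∣.m%n≡0⇒n∣m n (suc m) eq) ∤
  ... | suc r = ≈-trans
    (Σ-cong p λ t _ → ≈-trans
      (reflexive (cong ((+ t) ℤ.^_) (trans (ℕ.m≡m%n+[m/n]*n n (suc m)) (cong (ℕ._+ n ℕ./ suc m ℕ.* suc m) eq))))
      (^-periodic (+ t) r (n ℕ./ suc m)))
    (powerSum≈0 (suc r) (subst (_< suc m) eq (ℕ.m%n<n n (suc m))))

-- Points as roots

module _ {a b ℓ} {A : Set a} {B : Set b} (_≟_ : DecidableEquality B) {R : A → A → Set ℓ} (R? : B.Decidable R) (φ : A → B) where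

  map-filter-≢ : ∀ {x xs} → All (λ y → R x y ⇔ φ x ≡ φ y) xs →
    map φ (filter (¬? ∘ R? x) xs) ≡ filter (¬? ∘ (φ x ≟_)) (map φ xs)
  map-filter-≢ []                            = refl
  map-filter-≢ {x} {y ∷ ys} (R⇔≡ ∷ R⇔≡s) with R? x y | φ x ≟ φ y
  ... | yes _  | yes _  = map-filter-≢ R⇔≡s
  ... | yes r  | no  ≢  = contradiction (Equivalence.to R⇔≡ r) ≢
  ... | no  ¬r | yes e  = contradiction (Equivalence.from R⇔≡ e) ¬r
  ... | no  _  | no  _  = cong (φ y ∷_) (map-filter-≢ R⇔≡s)

  -- If `φ` is a complete invariant of `R` on the listed elements, both deduplications drop the same
  -- entries. The hypothesis is confined to `P` because the ratio x₁/x₂, to which this is applied,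
  -- is such an invariant only where x₂ is nonzero.
  map-deduplicate : ∀ {ℓ′} {P : A → Set ℓ′} → (∀ {x y} → P x → P y → R x y ⇔ φ x ≡ φ y) →
    ∀ {xs} → All P xs → map φ (deduplicate R? xs) ≡ deduplicate _≟_ (map φ xs)
  map-deduplicate R⇔≡ []         = refl
  map-deduplicate R⇔≡ (px ∷ pxs) = cong (φ _ ∷_)
    (trans (map-filter-≢ (All.map (R⇔≡ px) (All.deduplicate⁺ R? pxs)))
           (cong (filter (¬? ∘ (φ _ ≟_))) (map-deduplicate R⇔≡ pxs)))

^-distribʳ-* : ∀ a b n → (a ℤ.* b) ℤ.^ n ≡ a ℤ.^ n ℤ.* b ℤ.^ n
^-distribʳ-* a b zero    = refl
^-distribʳ-* a b (suc n) = trans (cong (a ℤ.* b ℤ.*_) (^-distribʳ-* a b n)) (eq a b (a ℤ.^ n) (b ℤ.^ n))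
  where eq : ∀ a b c d → a ℤ.* b ℤ.* (c ℤ.* d) ≡ a ℤ.* c ℤ.* (b ℤ.* d)
        eq = solve-∀

module PointCount {m : ℕ} (prime : Prime (2+ m)) where

  open PrimeField prime
  open ModularArithmetic p

  toℕ-≈-injective : ∀ {a b : Fin p} → ⌞ a ⌟ ≈ ⌞ b ⌟ → a ≡ b
  toℕ-≈-injective {a} {b} h = toℕ-injective (ℕ.≤-antisym (≤ a b h) (≤ b a (≈-sym h)))
    where
    ≤ : ∀ (a b : Fin p) → ⌞ a ⌟ ≈ ⌞ b ⌟ → toℕ a ℕ.≤ toℕ b
    ≤ a b h with toℕ a ℕ.≤? toℕ b
    ... | yes a≤b = a≤b
    ... | no  a≰b = contradiction
      (≈-trans (reflexive (trans (sym (ℤ.⊖-≥ (ℕ.<⇒≤ b<a))) (sym (ℤ.m-n≡m⊖n (toℕ a) (toℕ b))))) (≈⇒-≈0 h))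
      (<p⇒≉0 (ℕ.m<n⇒0<n∸m b<a) (ℕ.≤-<-trans (ℕ.m∸n≤m (toℕ a) (toℕ b)) (toℕ<n a)))
      where b<a = ℕ.≰⇒> a≰b

  -- Since m = p - 2, the power bᵐ is the inverse of a nonzero b by Fermat.
  quotient : Fin p → Fin p → Fin p
  quotient a b = fromℕ< (ℕ.m%n<n (toℕ a ℕ.* toℕ b ℕ.^ m) p)

  quotient-* : ∀ a b → ¬ ⌞ b ⌟ ≈ 0ℤ → ⌞ quotient a b ⌟ ℤ.* ⌞ b ⌟ ≈ ⌞ a ⌟
  quotient-* a b b≉0 = begin
    ⌞ quotient a b ⌟ ℤ.* ⌞ b ⌟                 ≡⟨ cong (λ x → + x ℤ.* ⌞ b ⌟) (toℕ-fromℕ< (ℕ.m%n<n (toℕ a ℕ.* toℕ b ℕ.^ m) p)) ⟩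
    + ((toℕ a ℕ.* toℕ b ℕ.^ m) ℕ.% p) ℤ.* ⌞ b ⌟ ≈⟨ *-congʳ ⌞ b ⌟ (residue (+ (toℕ a ℕ.* toℕ b ℕ.^ m))) ⟨
    + (toℕ a ℕ.* toℕ b ℕ.^ m) ℤ.* ⌞ b ⌟         ≡⟨ cong (ℤ._* ⌞ b ⌟) (trans (ℤ.pos-* (toℕ a) _) (cong (⌞ a ⌟ ℤ.*_) (pos-^ (toℕ b) m))) ⟩
    ⌞ a ⌟ ℤ.* ⌞ b ⌟ ℤ.^ m ℤ.* ⌞ b ⌟             ≡⟨ eq ⌞ a ⌟ (⌞ b ⌟ ℤ.^ m) ⌞ b ⌟ ⟩
    ⌞ a ⌟ ℤ.* ⌞ b ⌟ ℤ.^ suc m                   ≈⟨ *-congˡ ⌞ a ⌟ (fermat-unit ⌞ b ⌟ b≉0) ⟩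
    ⌞ a ⌟ ℤ.* 1ℤ                                ≡⟨ ℤ.*-identityʳ ⌞ a ⌟ ⟩
    ⌞ a ⌟                                       ∎
    where
    open ≈-Reasoning
    pos-^ : ∀ a n → + (a ℕ.^ n) ≡ (+ a) ℤ.^ n
    pos-^ a zero    = refl
    pos-^ a (suc n) = trans (ℤ.pos-* a _) (cong (+ a ℤ.*_) (pos-^ a n))
    eq : ∀ a c b → a ℤ.* c ℤ.* b ≡ a ℤ.* (b ℤ.* c)
    eq = solve-∀

  form-homogeneous : ∀ d μ t x y → t ℤ.* y ≈ x →
    form (suc d) μ x y ≈ y ℤ.^ suc d ℤ.* form (suc d) μ t 1ℤ
  form-homogeneous d μ t x y ty≈x = begin
    form (suc d) μ x y                ≈⟨ +-cong (+-cong (^-cong (suc d) ty≈x) ≈-refl)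
                                                (-‿cong (*-congʳ (y ℤ.^ d) (*-congˡ (+ suc d ℤ.* μ) ty≈x))) ⟨
    form (suc d) μ (t ℤ.* y) y        ≡⟨ cong (λ x → x ℤ.+ y ℤ.^ suc d ℤ.- + suc d ℤ.* μ ℤ.* (t ℤ.* y) ℤ.* y ℤ.^ d) (^-distribʳ-* t y (suc d)) ⟩
    t ℤ.^ suc d ℤ.* y ℤ.^ suc d ℤ.+ y ℤ.^ suc d ℤ.- + suc d ℤ.* μ ℤ.* (t ℤ.* y) ℤ.* y ℤ.^ d
      ≡⟨ eq (t ℤ.^ suc d) y (y ℤ.^ d) (+ suc d ℤ.* μ) t ⟩
    y ℤ.^ suc d ℤ.* (t ℤ.^ suc d ℤ.+ 1ℤ ℤ.- + suc d ℤ.* μ ℤ.* t ℤ.* 1ℤ)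
      ≡⟨ cong₂ (λ u v → y ℤ.^ suc d ℤ.* (t ℤ.^ suc d ℤ.+ u ℤ.- + suc d ℤ.* μ ℤ.* t ℤ.* v)) (ℤ.^-zeroˡ (suc d)) (ℤ.^-zeroˡ d) ⟨
    y ℤ.^ suc d ℤ.* form (suc d) μ t 1ℤ ∎
    where
    open ≈-Reasoning
    eq : ∀ tᵈ y yᵈ⁻¹ c t → tᵈ ℤ.* (y ℤ.* yᵈ⁻¹) ℤ.+ y ℤ.* yᵈ⁻¹ ℤ.- c ℤ.* (t ℤ.* y) ℤ.* yᵈ⁻¹
      ≡ y ℤ.* yᵈ⁻¹ ℤ.* (tᵈ ℤ.+ 1ℤ ℤ.- c ℤ.* t ℤ.* 1ℤ)
    eq = solve-∀

  Root : ℕ → ℤ → Fin p → Set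
  Root d μ t = form d μ ⌞ t ⌟ 1ℤ ≡ 0ℤ [𝔽 p ]

  root? : ∀ d μ → Decidable (Root d μ)
  root? d μ t = form d μ ⌞ t ⌟ 1ℤ ≡? 0ℤ [𝔽 p ]

  private
    from𝔽 : ∀ a b → a ≡ b [𝔽 p ] → a ≈ b
    from𝔽 _ _ h = modulo (ℤ∣.∣ᵤ⇒∣ h)

    to𝔽 : ∀ {a b} → a ≈ b → a ≡ b [𝔽 p ]
    to𝔽 (modulo h) = ℤ∣.∣⇒∣ᵤ h

  module _ (e : ℕ) (μ : ℤ) where

    private d = 2+ e

    vectors points : List (𝔽² p)
    vectors = cartesianProduct (allFin p) (allFin p)
    points  = filter (onHypersurface? d μ) (filter nonOrigin? vectors)

    Solution : 𝔽² p → Set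
    Solution x = NonOrigin x × OnHypersurface d μ x

    points-solutions : All Solution points
    points-solutions = All.zip
      ( All.filter⁺ (onHypersurface? d μ) (All.all-filter nonOrigin? vectors)
      , All.all-filter (onHypersurface? d μ) (filter nonOrigin? vectors))

    ∈-points⁺ : ∀ {x} → Solution x → x ∈ points
    ∈-points⁺ {x₁ , x₂} (n , h) = ∈.∈-filter⁺ (onHypersurface? d μ)
      (∈.∈-filter⁺ nonOrigin? (∈.∈-cartesianProduct⁺ (∈.∈-allFin x₁) (∈.∈-allFin x₂)) n) h

    -- There is no point at infinity: at x₂ = 0 the other two monomials vanish, the mixed one
    -- because d - 1 ≥ 1, and x₁ᵈ = 0 forces x₁ = 0, leaving only the origin.
    x₂≉0 : ∀ {x} → Solution x → ¬ ⌞ proj₂ x ⌟ ≈ 0ℤ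
    x₂≉0 {x₁ , x₂} (n , h) x₂≈0 = n (to𝔽 x₁≈0 , to𝔽 x₂≈0)
      where
      open ≈-Reasoning
      c = + d ℤ.* μ ℤ.* ⌞ x₁ ⌟
      eq : ∀ a → a ≡ a ℤ.+ 0ℤ ℤ.- 0ℤ
      eq = solve-∀
      x₁ᵈ≈0 : ⌞ x₁ ⌟ ℤ.^ d ≈ 0ℤ
      x₁ᵈ≈0 = begin
        ⌞ x₁ ⌟ ℤ.^ d                      ≡⟨ eq (⌞ x₁ ⌟ ℤ.^ d) ⟩
        ⌞ x₁ ⌟ ℤ.^ d ℤ.+ 0ℤ ℤ.- 0ℤ        ≈⟨ +-cong (+-congˡ (⌞ x₁ ⌟ ℤ.^ d) (*-zero-congˡ (⌞ x₂ ⌟ ℤ.^ suc e) x₂≈0))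
                                                   (-‿cong (*-zero-congʳ c (*-zero-congˡ (⌞ x₂ ⌟ ℤ.^ e) x₂≈0))) ⟨
        form d μ ⌞ x₁ ⌟ ⌞ x₂ ⌟            ≈⟨ from𝔽 (form d μ ⌞ x₁ ⌟ ⌞ x₂ ⌟) 0ℤ h ⟩
        0ℤ                                ∎
      x₁≈0 : ⌞ x₁ ⌟ ≈ 0ℤ
      x₁≈0 with ⌞ x₁ ⌟ ≡? 0ℤ [𝔽 p ]
      ... | yes x₁≈0 = from𝔽 ⌞ x₁ ⌟ 0ℤ x₁≈0
      ... | no  x₁≉0 = contradiction x₁ᵈ≈0 (^-≉0 {⌞ x₁ ⌟} d (x₁≉0 ∘ to𝔽))

    ratio : 𝔽² p → Fin p
    ratio (x₁ , x₂) = quotient x₁ x₂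

    ratio-root : ∀ {x} → Solution x → Root d μ (ratio x)
    ratio-root {x@(x₁ , x₂)} s@(_ , h) = to𝔽 ([ (λ y → contradiction y (^-≉0 {⌞ x₂ ⌟} d (x₂≉0 s))) , id ]′
      (euclid {⌞ x₂ ⌟ ℤ.^ d} {form d μ ⌞ ratio x ⌟ 1ℤ} (≈-trans
        (≈-sym (form-homogeneous (suc e) μ ⌞ ratio x ⌟ ⌞ x₁ ⌟ ⌞ x₂ ⌟ (quotient-* x₁ x₂ (x₂≉0 s))))
        (from𝔽 (form d μ ⌞ x₁ ⌟ ⌞ x₂ ⌟) 0ℤ h))))

    ∼⇔ratio : ∀ {x y} → Solution x → Solution y → x ∼ y ⇔ ratio x ≡ ratio y
    ∼⇔ratio {x@(x₁ , x₂)} {y@(y₁ , y₂)} sx sy = mk⇔ to from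
      where
      open ≈-Reasoning
      qx = quotient-* x₁ x₂ (x₂≉0 sx)
      qy = quotient-* y₁ y₂ (x₂≉0 sy)
      swap : ∀ a b c → a ℤ.* (b ℤ.* c) ≡ b ℤ.* (a ℤ.* c)
      swap = solve-∀
      to : x ∼ y → ratio x ≡ ratio y
      to (c , _ , cx₁ , cx₂) = toℕ-≈-injective (*-cancelˡ ⌞ y₂ ⌟ (x₂≉0 sy) (begin
        ⌞ y₂ ⌟ ℤ.* ⌞ ratio x ⌟              ≡⟨ ℤ.*-comm ⌞ y₂ ⌟ ⌞ ratio x ⌟ ⟩
        ⌞ ratio x ⌟ ℤ.* ⌞ y₂ ⌟              ≈⟨ *-congˡ ⌞ ratio x ⌟ (from𝔽 (⌞ c ⌟ ℤ.* ⌞ x₂ ⌟) ⌞ y₂ ⌟ cx₂) ⟨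
        ⌞ ratio x ⌟ ℤ.* (⌞ c ⌟ ℤ.* ⌞ x₂ ⌟)  ≡⟨ swap ⌞ ratio x ⌟ ⌞ c ⌟ ⌞ x₂ ⌟ ⟩
        ⌞ c ⌟ ℤ.* (⌞ ratio x ⌟ ℤ.* ⌞ x₂ ⌟)  ≈⟨ *-congˡ ⌞ c ⌟ qx ⟩
        ⌞ c ⌟ ℤ.* ⌞ x₁ ⌟                    ≈⟨ from𝔽 (⌞ c ⌟ ℤ.* ⌞ x₁ ⌟) ⌞ y₁ ⌟ cx₁ ⟩
        ⌞ y₁ ⌟                              ≈⟨ qy ⟨
        ⌞ ratio y ⌟ ℤ.* ⌞ y₂ ⌟              ≡⟨ ℤ.*-comm ⌞ ratio y ⌟ ⌞ y₂ ⌟ ⟩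
        ⌞ y₂ ⌟ ℤ.* ⌞ ratio y ⌟              ∎))
      from : ratio x ≡ ratio y → x ∼ y
      from eq = c , (λ c≈0 → x₂≉0 sy (≈-trans (≈-sym cx₂) (*-zero-congˡ ⌞ x₂ ⌟ (from𝔽 ⌞ c ⌟ 0ℤ c≈0)))) , to𝔽 cx₁ , to𝔽 cx₂
        where
        -- The second coordinates are nonzero, so the scalar can only be y₂/x₂.
        c : Fin p
        c = quotient y₂ x₂
        cx₂ : ⌞ c ⌟ ℤ.* ⌞ x₂ ⌟ ≈ ⌞ y₂ ⌟
        cx₂ = quotient-* y₂ x₂ (x₂≉0 sx)
        cx₁ : ⌞ c ⌟ ℤ.* ⌞ x₁ ⌟ ≈ ⌞ y₁ ⌟
        cx₁ = begin
          ⌞ c ⌟ ℤ.* ⌞ x₁ ⌟                    ≈⟨ *-congˡ ⌞ c ⌟ qx ⟨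
          ⌞ c ⌟ ℤ.* (⌞ ratio x ⌟ ℤ.* ⌞ x₂ ⌟)  ≡⟨ swap ⌞ c ⌟ ⌞ ratio x ⌟ ⌞ x₂ ⌟ ⟩
          ⌞ ratio x ⌟ ℤ.* (⌞ c ⌟ ℤ.* ⌞ x₂ ⌟)  ≈⟨ *-congˡ ⌞ ratio x ⌟ cx₂ ⟩
          ⌞ ratio x ⌟ ℤ.* ⌞ y₂ ⌟              ≡⟨ cong (λ t → ⌞ t ⌟ ℤ.* ⌞ y₂ ⌟) eq ⟩
          ⌞ ratio y ⌟ ℤ.* ⌞ y₂ ⌟              ≈⟨ qy ⟩
          ⌞ y₁ ⌟                              ∎

    1ₚ : Fin p
    1ₚ = Fin.suc Fin.zero

    root-solution : ∀ {t} → Root d μ t → Solution (t , 1ₚ)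
    root-solution h = (λ where (_ , 1≈0) → 1≉0 (from𝔽 1ℤ 0ℤ 1≈0)) , h

    ratio-affine : ∀ t → ratio (t , 1ₚ) ≡ t
    ratio-affine t = toℕ-≈-injective (≈-trans (reflexive (sym (ℤ.*-identityʳ _))) (quotient-* t 1ₚ 1≉0))

    -- Both lists are free of repetitions and have the same members, a root t being the ratio of the
    -- vector (t, 1); hence each is a permutation of the other.
    numberOfPoints≡numberOfRoots : numberOfPoints p d μ ≡ length (filter (root? d μ) (allFin p))
    numberOfPoints≡numberOfRoots = begin
      length (deduplicate _∼?_ points)                    ≡⟨ List.length-map ratio (deduplicate _∼?_ points) ⟨
      length (map ratio (deduplicate _∼?_ points))        ≡⟨ cong length (map-deduplicate Fin._≟_ _∼?_ ratio ∼⇔ratio points-solutions) ⟩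
      length (deduplicate Fin._≟_ (map ratio points))     ≡⟨ ↭-length (∼bag⇒↭ (∈.unique∧set⇒bag
                                                               (DecUnique.deduplicate-! Fin._≟_ (map ratio points))
                                                               (Unique.filter⁺ (root? d μ) (Unique.allFin⁺ p))
                                                               (mk⇔ to from))) ⟩
      length (filter (root? d μ) (allFin p))              ∎
      where
      open ≡-Reasoning
      to : ∀ {t} → t ∈ deduplicate Fin._≟_ (map ratio points) → t ∈ filter (root? d μ) (allFin p)
      to {t} h with ∈.∈-map⁻ ratio (∈.∈-deduplicate⁻ Fin._≟_ (map ratio points) h)
      ... | x , x∈ , refl = ∈.∈-filter⁺ (root? d μ) (∈.∈-allFin (ratio x)) (ratio-root (All.lookup points-solutions x∈))
      from : ∀ {t} → t ∈ filter (root? d μ) (allFin p) → t ∈ deduplicate Fin._≟_ (map ratio points)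
      from {t} h = ∈.∈-deduplicate⁺ Fin._≟_ (subst (_∈ map ratio points) (ratio-affine t)
        (∈.∈-map⁺ ratio (∈-points⁺ (root-solution {t} (proj₂ (∈.∈-filter⁻ (root? d μ) {xs = allFin p} h))))))

    length-filter≈sum : ∀ {P : Fin p → Set} (P? : Decidable P) (g : ℕ → ℤ) →
      (∀ i → P i → g (toℕ i) ≈ 1ℤ) → (∀ i → ¬ P i → g (toℕ i) ≈ 0ℤ) →
      + length (filter P? (allFin p)) ≈ Σ p g
    length-filter≈sum {P} P? g one none = go id
      where
      go : ∀ {n} (f : Fin n → Fin p) → + length (filter P? (tabulate f)) ≈ ΣP.sum {n} (λ i → g (toℕ (f i)))
      go {zero}  f = ≈-refl
      go {suc n} f with P? (f Fin.zero)
      ... | yes h = +-cong (≈-sym (one (f Fin.zero) h)) (go (f ∘ Fin.suc))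
      ... | no  h = ≈-trans (reflexive (sym (ℤ.+-identityˡ _))) (+-cong (≈-sym (none (f Fin.zero) h)) (go (f ∘ Fin.suc)))

    numberOfPoints≈Σ : + numberOfPoints p d μ ≈ Σ p (λ t → 1ℤ ℤ.- form d μ (+ t) 1ℤ ℤ.^ suc m)
    numberOfPoints≈Σ = ≈-trans (reflexive (cong +_ numberOfPoints≡numberOfRoots))
      (length-filter≈sum (root? d μ) (λ t → 1ℤ ℤ.- form d μ (+ t) 1ℤ ℤ.^ suc m)
        (λ i r → +-congˡ 1ℤ (-‿cong (*-zero-congˡ (form d μ ⌞ i ⌟ 1ℤ ℤ.^ m) (from𝔽 (form d μ ⌞ i ⌟ 1ℤ) 0ℤ r))))
        (λ i ¬r → +-congˡ 1ℤ (-‿cong (fermat-unit (form d μ ⌞ i ⌟ 1ℤ) (¬r ∘ to𝔽)))))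

-- The difference of the two point counts as a sum of binomial coefficients

module PointDifference {m : ℕ} (prime : Prime (2+ m)) (e : ℕ) (ℓ : ℤ) where

  open PrimeField prime
  open PointCount prime
  open ModularArithmetic p

  private
    d = 2+ e
    N = suc m

  D : ℤ
  D = + d ℤ.* ℓ

  contribution : ℕ → ℤ
  contribution k = + (((d ℕ.* k) ℕ.% N) C k) ℤ.* D ℤ.^ (N ∸ (d ℕ.* k) ℕ.% N)

  private
    F : ℤ → ℕ → ℤ
    F μ t = form d μ (+ t) 1ℤ

    Y : ℕ → ℤ
    Y t = (+ t) ℤ.^ d ℤ.+ 1ℤ

    F≡ : ∀ μ t → F μ t ≡ ℤ.- (+ d ℤ.* μ) ℤ.* + t ℤ.+ Y t
    F≡ μ t = trans (cong₂ (λ u v → (+ t) ℤ.^ d ℤ.+ u ℤ.- + d ℤ.* μ ℤ.* + t ℤ.* v) (ℤ.^-zeroˡ d) (ℤ.^-zeroˡ (suc e)))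
      (eq ((+ t) ℤ.^ d) (+ d ℤ.* μ) (+ t))
      where eq : ∀ u c t → u ℤ.+ 1ℤ ℤ.- c ℤ.* t ℤ.* 1ℤ ≡ ℤ.- c ℤ.* t ℤ.+ (u ℤ.+ 1ℤ)
            eq = solve-∀

    F0≡Y : ∀ t → F 0ℤ t ≡ Y t
    F0≡Y t = trans (F≡ 0ℤ t) (trans (cong (λ c → ℤ.- c ℤ.* + t ℤ.+ Y t) (ℤ.*-zeroʳ (+ d))) (eq (+ t) (Y t)))
      where eq : ∀ t y → ℤ.- 0ℤ ℤ.* t ℤ.+ y ≡ y
            eq = solve-∀

    -- The factor of tᵇ⁺¹⁺ᵈᵃ that comes from the (b+1)-st power of -Dt in `F ℓ t ℤ.^ N`, where the
    -- sign of C(p-1, b+1) has cancelled that of (-D)ᵇ⁺¹. The shift by one leaves out the power 0,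
    -- which gives the term shared with μ = 0; `m ∸ b` is the exponent p - 1 - (b+1) left for `Y t`.
    coefficient : ℕ → ℕ → ℤ
    coefficient b a = D ℤ.^ suc b ℤ.* + ((m ∸ b) C a)

    -- The range of a is stretched with vanishing binomials from n + 1 to p, so that it no longer
    -- depends on n; this allows the sums over a and b to be exchanged later.
    Y^ : ∀ t {n} → n < p → Y t ℤ.^ n ≈ Σ p (λ a → + (n C a) ℤ.* (+ t) ℤ.^ (d ℕ.* a))
    Y^ t {n} n<p = begin
      Y t ℤ.^ n                                                                  ≡⟨ binomialTheorem ((+ t) ℤ.^ d) 1ℤ n ⟩
      Σ (suc n) (λ a → + (n C a) ℤ.* (((+ t) ℤ.^ d) ℤ.^ a ℤ.* 1ℤ ℤ.^ (n ∸ a)))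
        ≈⟨ Σ-cong (suc n) {g = g} (λ a _ → reflexive (cong (+ (n C a) ℤ.*_) (term a))) ⟩
      Σ (suc n) g
        ≈⟨ Σ-extend n<p g (λ a n<a _ → *-zero-congˡ ((+ t) ℤ.^ (d ℕ.* a)) (reflexive (cong +_ (k>n⇒nCk≡0 n<a)))) ⟨
      Σ p g                                                                      ∎
      where
      open ≈-Reasoning
      g : ℕ → ℤ
      g a = + (n C a) ℤ.* (+ t) ℤ.^ (d ℕ.* a)
      term : ∀ a → ((+ t) ℤ.^ d) ℤ.^ a ℤ.* 1ℤ ℤ.^ (n ∸ a) ≡ (+ t) ℤ.^ (d ℕ.* a)
      term a = trans (cong₂ ℤ._*_ (ℤ.^-*-assoc (+ t) d a) (ℤ.^-zeroˡ (n ∸ a))) (ℤ.*-identityʳ _)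

    [-c]^*±1≡c^ : ∀ c n → -1ℤ ℤ.^ n ℤ.* (ℤ.- c) ℤ.^ n ≡ c ℤ.^ n
    [-c]^*±1≡c^ c n = trans (sym (^-distribʳ-* -1ℤ (ℤ.- c) n)) (cong (ℤ._^ n) (eq c))
      where eq : ∀ c → -1ℤ ℤ.* ℤ.- c ≡ c
            eq = solve-∀

    F^ : ∀ t → F ℓ t ℤ.^ N ≈ Y t ℤ.^ N ℤ.+
      Σ N (λ b → Σ p (λ a → coefficient b a ℤ.* (+ t) ℤ.^ (suc b ℕ.+ d ℕ.* a)))
    F^ t = begin
      F ℓ t ℤ.^ N                                          ≡⟨ cong (ℤ._^ N) (F≡ ℓ t) ⟩
      (ℤ.- D ℤ.* + t ℤ.+ Y t) ℤ.^ N                        ≡⟨ binomialTheorem (ℤ.- D ℤ.* + t) (Y t) N ⟩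
      g 0 ℤ.+ Σ N (g ∘ suc)
        ≈⟨ +-cong (reflexive (trans (ℤ.*-identityˡ (1ℤ ℤ.* Y t ℤ.^ N)) (ℤ.*-identityˡ (Y t ℤ.^ N)))) (Σ-cong N term) ⟩
      Y t ℤ.^ N ℤ.+ Σ N (λ b → Σ p (λ a → coefficient b a ℤ.* (+ t) ℤ.^ (suc b ℕ.+ d ℕ.* a))) ∎
      where
      open ≈-Reasoning
      g : ℕ → ℤ
      g b = + (N C b) ℤ.* ((ℤ.- D ℤ.* + t) ℤ.^ b ℤ.* Y t ℤ.^ (N ∸ b))
      eq₁ : ∀ s c t y → s ℤ.* (c ℤ.* t ℤ.* y) ≡ s ℤ.* c ℤ.* t ℤ.* y
      eq₁ = solve-∀
      eq₂ : ∀ c t k u → c ℤ.* t ℤ.* (k ℤ.* u) ≡ c ℤ.* k ℤ.* (t ℤ.* u)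
      eq₂ = solve-∀
      term : ∀ b → b < N → g (suc b) ≈ Σ p (λ a → coefficient b a ℤ.* (+ t) ℤ.^ (suc b ℕ.+ d ℕ.* a))
      term b b<N = begin
        g (suc b) ≈⟨ *-cong ([p-1]Ck≈±1 (s<s b<N)) (*-cong (reflexive (^-distribʳ-* (ℤ.- D) (+ t) (suc b))) (Y^ t (s≤s (ℕ.m≤n⇒m≤1+n (ℕ.m∸n≤m m b))))) ⟩
        -1ℤ ℤ.^ suc b ℤ.* ((ℤ.- D) ℤ.^ suc b ℤ.* (+ t) ℤ.^ suc b ℤ.* Σ p y) ≡⟨ eq₁ (-1ℤ ℤ.^ suc b) ((ℤ.- D) ℤ.^ suc b) ((+ t) ℤ.^ suc b) (Σ p y) ⟩
        -1ℤ ℤ.^ suc b ℤ.* (ℤ.- D) ℤ.^ suc b ℤ.* (+ t) ℤ.^ suc b ℤ.* Σ p y   ≡⟨ cong (λ c → c ℤ.* (+ t) ℤ.^ suc b ℤ.* Σ p y) ([-c]^*±1≡c^ D (suc b)) ⟩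
        D ℤ.^ suc b ℤ.* (+ t) ℤ.^ suc b ℤ.* Σ p y                           ≈⟨ Σ-*ˡ p (D ℤ.^ suc b ℤ.* (+ t) ℤ.^ suc b) y ⟩
        Σ p (λ a → D ℤ.^ suc b ℤ.* (+ t) ℤ.^ suc b ℤ.* y a)
          ≈⟨ Σ-cong p {g = λ a → coefficient b a ℤ.* (+ t) ℤ.^ (suc b ℕ.+ d ℕ.* a)} (λ a _ → reflexive (trans
               (eq₂ (D ℤ.^ suc b) ((+ t) ℤ.^ suc b) (+ ((m ∸ b) C a)) ((+ t) ℤ.^ (d ℕ.* a)))
               (cong (coefficient b a ℤ.*_) (sym (ℤ.^-distribˡ-+-* (+ t) (suc b) (d ℕ.* a)))))) ⟩
        Σ p (λ a → coefficient b a ℤ.* (+ t) ℤ.^ (suc b ℕ.+ d ℕ.* a))       ∎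
        where
        y : ℕ → ℤ
        y a = + ((m ∸ b) C a) ℤ.* (+ t) ℤ.^ (d ℕ.* a)

    -- Given a, the only b < p - 1 with p - 1 ∣ b + 1 + d a is p - 2 - (d a mod (p - 1)).
    select : ∀ a → Σ N (λ b → coefficient b a ℤ.* ℤ.- powerSum (suc b ℕ.+ d ℕ.* a)) ≈ contribution a
    select a = begin
      Σ N g                                           ≈⟨ Σ-single b₀<N g others ⟩
      g b₀                                            ≈⟨ *-congˡ (coefficient b₀ a) (-‿cong (powerSum-∣ (b₀ ℕ.+ d ℕ.* a) N∣)) ⟩
      coefficient b₀ a ℤ.* 1ℤ                         ≡⟨ ℤ.*-identityʳ (coefficient b₀ a) ⟩
      D ℤ.^ suc b₀ ℤ.* + ((m ∸ b₀) C a)               ≡⟨ ℤ.*-comm (D ℤ.^ suc b₀) _ ⟩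
      + ((m ∸ b₀) C a) ℤ.* D ℤ.^ suc b₀               ≡⟨ cong₂ (λ x y → + (x C a) ℤ.* D ℤ.^ y) (ℕ.m∸[m∸n]≡n r≤m) (sym (ℕ.+-∸-assoc 1 r≤m)) ⟩
      contribution a                                  ∎
      where
      open ≈-Reasoning
      r = (d ℕ.* a) ℕ.% N
      i = (d ℕ.* a) ℕ./ N
      r≤m : r ≤ m
      r≤m = ℕ.s≤s⁻¹ (ℕ.m%n<n (d ℕ.* a) N)
      b₀ = m ∸ r
      b₀<N : b₀ < N
      b₀<N = s≤s (ℕ.m∸n≤m m r)
      g : ℕ → ℤ
      g b = coefficient b a ℤ.* ℤ.- powerSum (suc b ℕ.+ d ℕ.* a)
      b₀+da : suc b₀ ℕ.+ d ℕ.* a ≡ suc i ℕ.* N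
      b₀+da = trans (cong (suc b₀ ℕ.+_) (ℕ.m≡m%n+[m/n]*n (d ℕ.* a) N))
        (trans (sym (ℕ.+-assoc (suc b₀) r (i ℕ.* N))) (cong (λ x → suc x ℕ.+ i ℕ.* N) (ℕ.m∸n+n≡m r≤m)))
      N∣ : N ∣ suc (b₀ ℕ.+ d ℕ.* a)
      N∣ = divides (suc i) b₀+da
      others : ∀ b → b < N → b ≢ b₀ → g b ≈ 0ℤ
      others b b<N b≢b₀ = *-zero-congʳ (coefficient b a) (-‿cong (powerSum-∤ (suc b ℕ.+ d ℕ.* a) λ N∣b → b≢b₀ (unique N∣b)))
        where
        N∣b+r : N ∣ suc b ℕ.+ d ℕ.* a → N ∣ suc b ℕ.+ r
        N∣b+r h = ℕ∣.∣m+n∣m⇒∣n (subst (N ∣_)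
          (trans (cong (suc b ℕ.+_) (ℕ.m≡m%n+[m/n]*n (d ℕ.* a) N))
            (trans (sym (ℕ.+-assoc (suc b) r (i ℕ.* N))) (ℕ.+-comm (suc b ℕ.+ r) (i ℕ.* N)))) h) (ℕ∣.n∣m*n i)
        unique : N ∣ suc b ℕ.+ d ℕ.* a → b ≡ b₀
        unique h with N∣b+r h
        ... | divides zero    ()
        ... | divides 1       eq = trans (sym (ℕ.m+n∸n≡m b r)) (cong (_∸ r) (trans (ℕ.suc-injective eq) (ℕ.+-identityʳ m)))
        -- Since b + 1 ≤ p - 1 and r ≤ p - 2, the sum b + 1 + r stays below 2(p - 1).
        ... | divides (2+ j) eq = contradiction
          (ℕ.+-mono-≤-< b<N (s≤s r≤m)) (ℕ.≤⇒≯ (subst (N ℕ.+ N ≤_) (sym eq) (ℕ.+-monoʳ-≤ N (ℕ.m≤m+n N (j ℕ.* N)))))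

  -- The sums are exchanged until t is innermost, which leaves power sums. The minus sign in 1 -
  -- Fᵖ⁻¹ cancels against the value -1 of the power sums that survive.
  numberOfPoints-difference : + numberOfPoints p d ℓ ℤ.- + numberOfPoints p d 0ℤ ≈ Σ p contribution
  numberOfPoints-difference = begin
    + numberOfPoints p d ℓ ℤ.- + numberOfPoints p d 0ℤ   ≈⟨ +-cong (numberOfPoints≈Σ e ℓ) (-‿cong (numberOfPoints≈Σ e 0ℤ)) ⟩
    Σ p (G ℓ) ℤ.- Σ p (G 0ℤ)                             ≡⟨ cong (ℤ._+_ (Σ p (G ℓ))) (ℤ.-1*i≡-i (Σ p (G 0ℤ))) ⟨
    Σ p (G ℓ) ℤ.+ -1ℤ ℤ.* Σ p (G 0ℤ)                     ≈⟨ +-congˡ (Σ p (G ℓ)) (Σ-*ˡ p -1ℤ (G 0ℤ)) ⟩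
    Σ p (G ℓ) ℤ.+ Σ p (λ t → -1ℤ ℤ.* G 0ℤ t)             ≈⟨ Σ-+ p (G ℓ) (λ t → -1ℤ ℤ.* G 0ℤ t) ⟨
    Σ p (λ t → G ℓ t ℤ.+ -1ℤ ℤ.* G 0ℤ t)                 ≈⟨ Σ-cong p {g = λ t → -1ℤ ℤ.* Σ N (λ b → Σ p (λ a → T b a t))} (λ t _ → term t) ⟩
    Σ p (λ t → -1ℤ ℤ.* Σ N (λ b → Σ p (λ a → T b a t)))  ≈⟨ Σ-*ˡ p -1ℤ (λ t → Σ N (λ b → Σ p (λ a → T b a t))) ⟨
    -1ℤ ℤ.* Σ p (λ t → Σ N (λ b → Σ p (λ a → T b a t)))  ≈⟨ *-congˡ -1ℤ (Σ-comm p N (λ t b → Σ p (λ a → T b a t))) ⟩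
    -1ℤ ℤ.* Σ N (λ b → Σ p (λ t → Σ p (λ a → T b a t)))
      ≈⟨ *-congˡ -1ℤ (Σ-cong N λ b _ → ≈-trans (Σ-comm p p (λ t a → T b a t))
           (Σ-cong p {g = λ a → S b a} (λ a _ → ≈-sym (Σ-*ˡ p (coefficient b a) (λ t → (+ t) ℤ.^ (suc b ℕ.+ d ℕ.* a)))))) ⟩
    -1ℤ ℤ.* Σ N (λ b → Σ p (λ a → S b a))                ≈⟨ *-congˡ -1ℤ (Σ-comm N p S) ⟩
    -1ℤ ℤ.* Σ p (λ a → Σ N (λ b → S b a))                ≈⟨ Σ-*ˡ p -1ℤ (λ a → Σ N (λ b → S b a)) ⟩
    Σ p (λ a → -1ℤ ℤ.* Σ N (λ b → S b a))
      ≈⟨ Σ-cong p {g = contribution} (λ a _ → ≈-trans (Σ-*ˡ N -1ℤ (λ b → S b a)) (≈-trans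
           (Σ-cong N {g = λ b → coefficient b a ℤ.* ℤ.- powerSum (suc b ℕ.+ d ℕ.* a)}
             (λ b _ → reflexive (eq₂ (coefficient b a) (powerSum (suc b ℕ.+ d ℕ.* a)))))
           (select a))) ⟩
    Σ p contribution                                     ∎
    where
    open ≈-Reasoning
    G : ℤ → ℕ → ℤ
    G μ t = 1ℤ ℤ.- F μ t ℤ.^ N
    T : ℕ → ℕ → ℕ → ℤ
    T b a t = coefficient b a ℤ.* (+ t) ℤ.^ (suc b ℕ.+ d ℕ.* a)
    S : ℕ → ℕ → ℤ
    S b a = coefficient b a ℤ.* powerSum (suc b ℕ.+ d ℕ.* a)
    eq₁ : ∀ y s → 1ℤ ℤ.- (y ℤ.+ s) ℤ.+ -1ℤ ℤ.* (1ℤ ℤ.- y) ≡ -1ℤ ℤ.* s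
    eq₁ = solve-∀
    eq₂ : ∀ c s → -1ℤ ℤ.* (c ℤ.* s) ≡ c ℤ.* ℤ.- s
    eq₂ = solve-∀
    term : ∀ t → G ℓ t ℤ.+ -1ℤ ℤ.* G 0ℤ t ≈ -1ℤ ℤ.* Σ N (λ b → Σ p (λ a → T b a t))
    term t = ≈-trans
      (+-cong (+-congˡ 1ℤ (-‿cong (F^ t))) (*-congˡ -1ℤ (+-congˡ 1ℤ (-‿cong (reflexive (cong (ℤ._^ N) (F0≡Y t)))))))
      (reflexive (eq₁ (Y t ℤ.^ N) (Σ N (λ b → Σ p (λ a → T b a t)))))

-- Hypergeometric terms as binomial coefficients

-- `a / 1` is normalised through a gcd and is stuck for a variable `a`. The explicit fraction
-- computes, so the homomorphism laws and the order can be read off from it.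
fromℤ≡mkℚ : ∀ a → fromℤ a ≡ mkℚ a 0 (Coprimality.sym (Coprimality.1-coprimeTo ℤ.∣ a ∣))
fromℤ≡mkℚ a = ℚ.↥p/↧p≡p (mkℚ a 0 (Coprimality.sym (Coprimality.1-coprimeTo ℤ.∣ a ∣)))

fromℤ-+ : ∀ a b → fromℤ (a ℤ.+ b) ≡ fromℤ a + fromℤ b
fromℤ-+ a b = sym (trans (cong₂ _+_ (fromℤ≡mkℚ a) (fromℤ≡mkℚ b))
  (cong fromℤ (cong₂ ℤ._+_ (ℤ.*-identityʳ a) (ℤ.*-identityʳ b))))

fromℤ-* : ∀ a b → fromℤ (a ℤ.* b) ≡ fromℤ a * fromℤ b
fromℤ-* a b = sym (cong₂ _*_ (fromℤ≡mkℚ a) (fromℤ≡mkℚ b))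

fromℤ-^ : ∀ a n → fromℤ (a ℤ.^ n) ≡ fromℤ a ^ n
fromℤ-^ a zero    = refl
fromℤ-^ a (suc n) = trans (fromℤ-* a (a ℤ.^ n)) (cong (fromℤ a *_) (fromℤ-^ a n))

fromℤ-injective : ∀ a b → fromℤ a ≡ fromℤ b → a ≡ b
fromℤ-injective a b eq = trans (sym (cong ↥_ (fromℤ≡mkℚ a))) (trans (cong ↥_ eq) (cong ↥_ (fromℤ≡mkℚ b)))

fromℕ-* : ∀ a b → fromℕ (a ℕ.* b) ≡ fromℕ a * fromℕ b
fromℕ-* a b = trans (cong fromℤ (ℤ.pos-* a b)) (fromℤ-* (+ a) (+ b))

fromℕ≢0 : ∀ n → n ≢ 0 → fromℕ n ≢ 0ℚ
fromℕ≢0 n n≢0 eq = n≢0 (ℤ.+-injective (fromℤ-injective (+ n) 0ℤ eq))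

!≢0 : ∀ n → fromℕ (n !) ≢ 0ℚ
!≢0 n = fromℕ≢0 (n !) (ℕ.≢-nonZero⁻¹ (n !) {{n ℕ.!≢0}})

⁻¹-inverseˡ : ∀ {q} → q ≢ 0ℚ → q ⁻¹ * q ≡ 1ℚ
⁻¹-inverseˡ {q} q≢0 with q ℚ.≟ 0ℚ
... | yes q≡0 = contradiction q≡0 q≢0
... | no  ¬q≡0 = ℚ.*-inverseˡ q {{ℚ.≢-nonZero ¬q≡0}}

*-cancelʳ : ∀ {x y} q → q ≢ 0ℚ → x * q ≡ y * q → x ≡ y
*-cancelʳ {x} {y} q q≢0 eq = trans (unit x) (trans (cong (_* q ⁻¹) eq) (sym (unit y)))
  where
  unit : ∀ x → x ≡ x * q * q ⁻¹
  unit x = sym (trans (solve 3 (λ x q r → x :* q :* r := x :* (r :* q)) refl x q (q ⁻¹))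
    (trans (cong (x *_) (⁻¹-inverseˡ q≢0)) (ℚ.*-identityʳ x)))

*-≢0 : ∀ {x y} → x ≢ 0ℚ → y ≢ 0ℚ → x * y ≢ 0ℚ
*-≢0 {x} {y} x≢0 y≢0 eq = x≢0 (*-cancelʳ y y≢0 (trans eq (sym (ℚ.*-zeroˡ y))))

*-≢0ˡ : ∀ {x} y → x * y ≢ 0ℚ → x ≢ 0ℚ
*-≢0ˡ y xy≢0 refl = xy≢0 (ℚ.*-zeroˡ y)

1^ : ∀ n → 1ℚ ^ n ≡ 1ℚ
1^ zero    = refl
1^ (suc n) = trans (ℚ.*-identityˡ (1ℚ ^ n)) (1^ n)

^-distribʳ-*ℚ : ∀ x y n → (x * y) ^ n ≡ x ^ n * y ^ n
^-distribʳ-*ℚ x y zero    = refl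
^-distribʳ-*ℚ x y (suc n) = trans (cong (x * y *_) (^-distribʳ-*ℚ x y n))
  (solve 4 (λ x y u v → x :* y :* (u :* v) := x :* u :* (y :* v)) refl x y (x ^ n) (y ^ n))

^-+ : ∀ x m n → x ^ (m ℕ.+ n) ≡ x ^ m * x ^ n
^-+ x zero    n = sym (ℚ.*-identityˡ (x ^ n))
^-+ x (suc m) n = trans (cong (x *_) (^-+ x m n)) (sym (ℚ.*-assoc x (x ^ m) (x ^ n)))

^-* : ∀ x m n → x ^ (m ℕ.* n) ≡ (x ^ m) ^ n
^-* x m zero    = cong (x ^_) (ℕ.*-zeroʳ m)
^-* x m (suc n) = trans (cong (x ^_) (ℕ.*-suc m n)) (trans (^-+ x m (m ℕ.* n)) (cong (x ^ m *_) (^-* x m n)))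

^-≢0 : ∀ x n → x ≢ 0ℚ → x ^ n ≢ 0ℚ
^-≢0 x zero    x≢0 ()
^-≢0 x (suc n) x≢0 = *-≢0 x≢0 (^-≢0 x n x≢0)

∏-++ : ∀ xs ys f → ∏ (xs ++ ys) f ≡ ∏ xs f * ∏ ys f
∏-++ []       ys f = sym (ℚ.*-identityˡ (∏ ys f))
∏-++ (x ∷ xs) ys f = trans (cong (f x *_) (∏-++ xs ys f)) (sym (ℚ.*-assoc (f x) (∏ xs f) (∏ ys f)))

∏-* : ∀ xs f g → ∏ xs (λ x → f x * g x) ≡ ∏ xs f * ∏ xs g
∏-* []       f g = refl
∏-* (x ∷ xs) f g = trans (cong (f x * g x *_) (∏-* xs f g))
  (solve 4 (λ a b u v → a :* b :* (u :* v) := a :* u :* (b :* v)) refl (f x) (g x) (∏ xs f) (∏ xs g))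

∏-1 : ∀ xs → ∏ xs (λ _ → 1ℚ) ≡ 1ℚ
∏-1 []       = refl
∏-1 (x ∷ xs) = trans (ℚ.*-identityˡ (∏ xs (λ _ → 1ℚ))) (∏-1 xs)

-- The factors are (a+1)/c, ..., (a+l)/c. Cleared of denominators, their product carries a! to
-- (a+l)!, so that runs of consecutive integers can be chained, each starting where the previous one
-- ends.
∏-consecutive : ∀ c a l (x : ℕ → ℚ) f → (∀ j → f (x j) * c ≡ fromℕ (suc (a ℕ.+ j))) →
  ∏ (applyUpTo x l) f * (c ^ l * fromℕ (a !)) ≡ fromℕ ((a ℕ.+ l) !)
∏-consecutive c a zero    x f h = trans (ℚ.*-identityˡ _) (trans (ℚ.*-identityˡ _) (cong (fromℕ ∘ _!) (sym (ℕ.+-identityʳ a))))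
∏-consecutive c a (suc l) x f h = begin
  f (x 0) * R * (c * c ^ l * fromℕ (a !))
    ≡⟨ solve 5 (λ u R c v w → u :* R :* (c :* v :* w) := R :* (v :* (u :* c :* w))) refl (f (x 0)) R c (c ^ l) (fromℕ (a !)) ⟩
  R * (c ^ l * (f (x 0) * c * fromℕ (a !)))  ≡⟨ cong (λ y → R * (c ^ l * (y * fromℕ (a !)))) (trans (h 0) (cong (fromℕ ∘ suc) (ℕ.+-identityʳ a))) ⟩
  R * (c ^ l * (fromℕ (suc a) * fromℕ (a !))) ≡⟨ cong (λ y → R * (c ^ l * y)) (fromℕ-* (suc a) (a !)) ⟨
  R * (c ^ l * fromℕ (suc a !))              ≡⟨ ∏-consecutive c (suc a) l (x ∘ suc) f (λ j → trans (h (suc j)) (cong (fromℕ ∘ suc) (ℕ.+-suc a j))) ⟩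
  fromℕ ((suc a ℕ.+ l) !)                    ≡⟨ cong (fromℕ ∘ _!) (ℕ.+-suc a l) ⟨
  fromℕ ((a ℕ.+ suc l) !)                    ∎
  where
  open ≡-Reasoning
  R = ∏ (applyUpTo (x ∘ suc) l) f

incrementFirst-applyUpTo : ∀ i r g →
  incrementFirst i (applyUpTo g (i ℕ.+ r)) ≡ applyUpTo ((_+ 1ℚ) ∘ g) i ++ applyUpTo (g ∘ (i ℕ.+_)) r
incrementFirst-applyUpTo zero    r g = refl
incrementFirst-applyUpTo (suc i) r g = cong (g 0 + 1ℚ ∷_) (incrementFirst-applyUpTo i r (g ∘ suc))

-- (1/n)ₖ ⋯ ((n-1)/n)ₖ k! = (nk)!/nⁿᵏ, and incrementing the first i parameters
-- multiplies the left side by (nk+1) ⋯ (nk+i) / i!.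
∏-pochhammer : ∀ i r k → let n = suc (i ℕ.+ r) in
  ∏ (incrementFirst i (fractions n)) (λ x → pochhammer x k) *
    (fromℕ (k !) * (fromℕ n ^ (n ℕ.* k) * fromℕ (i !))) ≡ fromℕ ((n ℕ.* k ℕ.+ i) !)
∏-pochhammer i r k = go k
  where
  open ≡-Reasoning
  n = suc (i ℕ.+ r)
  c = fromℕ n
  c≢0 : c ≢ 0ℚ
  c≢0 = fromℕ≢0 n λ ()
  g : ℕ → ℚ
  g j = fromℕ (suc j) ÷ c
  xs = incrementFirst i (fractions n)
  ys = applyUpTo ((_+ 1ℚ) ∘ g) i
  zs = applyUpTo (g ∘ (i ℕ.+_)) r
  xs≡ : xs ≡ ys ++ zs
  xs≡ = trans (cong (incrementFirst i) (List.map-applyUpTo id g (i ℕ.+ r))) (incrementFirst-applyUpTo i r g)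
  P : ℕ → ℚ
  P k = ∏ xs (λ x → pochhammer x k)
  g-c : ∀ j → g j * c ≡ fromℕ (suc j)
  g-c j = trans (ℚ.*-assoc (fromℕ (suc j)) (c ⁻¹) c)
    (trans (cong (fromℕ (suc j) *_) (⁻¹-inverseˡ c≢0)) (ℚ.*-identityʳ (fromℕ (suc j))))
  y-c : ∀ k j → (g j + 1ℚ + fromℕ k) * c ≡ fromℕ (suc (n ℕ.* k ℕ.+ n ℕ.+ j))
  y-c k j = begin
    (g j + 1ℚ + fromℕ k) * c             ≡⟨ solve 4 (λ g o k c → (g :+ o :+ k) :* c := g :* c :+ (o :* c :+ k :* c)) refl (g j) 1ℚ (fromℕ k) c ⟩
    g j * c + (1ℚ * c + fromℕ k * c)     ≡⟨ cong₂ _+_ (g-c j) (cong₂ _+_ (ℚ.*-identityˡ c) (sym (fromℕ-* k n))) ⟩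
    fromℕ (suc j) + (c + fromℕ (k ℕ.* n)) ≡⟨ cong (λ y → fromℕ (suc j) + y) (fromℤ-+ (+ n) (+ (k ℕ.* n))) ⟨
    fromℕ (suc j) + fromℕ (n ℕ.+ k ℕ.* n) ≡⟨ fromℤ-+ (+ suc j) (+ (n ℕ.+ k ℕ.* n)) ⟨
    fromℕ (suc j ℕ.+ (n ℕ.+ k ℕ.* n))    ≡⟨ cong fromℕ (eq j n k) ⟩
    fromℕ (suc (n ℕ.* k ℕ.+ n ℕ.+ j))    ∎
    where eq : ∀ j n k → suc j ℕ.+ (n ℕ.+ k ℕ.* n) ≡ suc (n ℕ.* k ℕ.+ n ℕ.+ j)
          eq = ℕSolver.solve-∀
  z-c : ∀ k j → (g (i ℕ.+ j) + fromℕ k) * c ≡ fromℕ (suc (n ℕ.* k ℕ.+ i ℕ.+ j))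
  z-c k j = begin
    (g (i ℕ.+ j) + fromℕ k) * c               ≡⟨ ℚ.*-distribʳ-+ c (g (i ℕ.+ j)) (fromℕ k) ⟩
    g (i ℕ.+ j) * c + fromℕ k * c             ≡⟨ cong₂ _+_ (g-c (i ℕ.+ j)) (sym (fromℕ-* k n)) ⟩
    fromℕ (suc (i ℕ.+ j)) + fromℕ (k ℕ.* n)   ≡⟨ fromℤ-+ (+ suc (i ℕ.+ j)) (+ (k ℕ.* n)) ⟨
    fromℕ (suc (i ℕ.+ j) ℕ.+ k ℕ.* n)         ≡⟨ cong fromℕ (eq i j n k) ⟩
    fromℕ (suc (n ℕ.* k ℕ.+ i ℕ.+ j))         ∎
    where eq : ∀ i j n k → suc (i ℕ.+ j) ℕ.+ k ℕ.* n ≡ suc (n ℕ.* k ℕ.+ i ℕ.+ j)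
          eq = ℕSolver.solve-∀
  go : ∀ k → P k * (fromℕ (k !) * (c ^ (n ℕ.* k) * fromℕ (i !))) ≡ fromℕ ((n ℕ.* k ℕ.+ i) !)
  go zero = begin
    P 0 * (1ℚ * (c ^ (n ℕ.* 0) * fromℕ (i !))) ≡⟨ cong₂ (λ x y → x * (1ℚ * (c ^ y * fromℕ (i !)))) (∏-1 xs) (ℕ.*-zeroʳ n) ⟩
    1ℚ * (1ℚ * (1ℚ * fromℕ (i !)))             ≡⟨ trans (ℚ.*-identityˡ _) (trans (ℚ.*-identityˡ _) (ℚ.*-identityˡ _)) ⟩
    fromℕ (i !)                                ≡⟨ cong (λ y → fromℕ ((y ℕ.+ i) !)) (ℕ.*-zeroʳ n) ⟨
    fromℕ ((n ℕ.* 0 ℕ.+ i) !)                  ∎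
  -- Passing to k + 1 must multiply (nk+i)! by nk+i+1, ..., nk+n+i. The r unshifted parameters
  -- supply the integers up to nk+n-1, the new factor k+1 of the factorial together with one factor
  -- n supplies nk+n, and the i shifted parameters supply the rest.
  go (suc k) = begin
    P (suc k) * (fromℕ (suc k !) * (c ^ (n ℕ.* suc k) * I))
      ≡⟨ cong₂ _*_ P-suc (cong₂ _*_ (fromℕ-* (suc k) (k !)) (cong (_* I) c^-suc)) ⟩
    P k * (A * B) * (fromℕ (suc k) * K * (c * (c ^ i * c ^ r) * E * I))
      ≡⟨ solve 10 (λ P A B s K c u v E I → P :* (A :* B) :* (s :* K :* (c :* (u :* v) :* E :* I)) :=
                     A :* (u :* (c :* s :* (B :* (v :* (P :* (K :* (E :* I)))))))) refl (P k) A B (fromℕ (suc k)) K c (c ^ i) (c ^ r) E I ⟩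
    A * (c ^ i * (c * fromℕ (suc k) * (B * (c ^ r * (P k * (K * (E * I)))))))
      ≡⟨ cong (λ x → A * (c ^ i * (c * fromℕ (suc k) * (B * (c ^ r * x))))) (go k) ⟩
    A * (c ^ i * (c * fromℕ (suc k) * (B * (c ^ r * fromℕ ((n ℕ.* k ℕ.+ i) !)))))
      ≡⟨ cong (λ x → A * (c ^ i * (c * fromℕ (suc k) * x)))
           (∏-consecutive c (n ℕ.* k ℕ.+ i) r (g ∘ (i ℕ.+_)) (_+ fromℕ k) (z-c k)) ⟩
    A * (c ^ i * (c * fromℕ (suc k) * fromℕ ((n ℕ.* k ℕ.+ i ℕ.+ r) !)))
      ≡⟨ cong (λ x → A * (c ^ i * x)) (trans (cong (_* fromℕ ((n ℕ.* k ℕ.+ i ℕ.+ r) !)) (sym (fromℕ-* n (suc k))))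
           (trans (sym (fromℕ-* (n ℕ.* suc k) ((n ℕ.* k ℕ.+ i ℕ.+ r) !))) (cong fromℕ (fold (i ℕ.+ r) k eq₁ (ℕ.+-assoc (n ℕ.* k) i r))))) ⟩
    A * (c ^ i * fromℕ ((n ℕ.* k ℕ.+ n) !))
      ≡⟨ ∏-consecutive c (n ℕ.* k ℕ.+ n) i ((_+ 1ℚ) ∘ g) (_+ fromℕ k) (y-c k) ⟩
    fromℕ ((n ℕ.* k ℕ.+ n ℕ.+ i) !)
      ≡⟨ cong (λ y → fromℕ ((y ℕ.+ i) !)) eq₁ ⟨
    fromℕ ((n ℕ.* suc k ℕ.+ i) !) ∎
    where
    A = ∏ ys (_+ fromℕ k)
    B = ∏ zs (_+ fromℕ k)
    I = fromℕ (i !)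
    K = fromℕ (k !)
    E = c ^ (n ℕ.* k)
    P-suc : P (suc k) ≡ P k * (A * B)
    P-suc = trans (∏-* xs (λ x → pochhammer x k) (_+ fromℕ k))
      (cong (P k *_) (trans (cong (λ l → ∏ l (_+ fromℕ k)) xs≡) (∏-++ ys zs (_+ fromℕ k))))
    c^-suc : c ^ (n ℕ.* suc k) ≡ c * (c ^ i * c ^ r) * E
    c^-suc = trans (cong (c ^_) (ℕ.*-suc n k)) (trans (^-+ c n (n ℕ.* k)) (cong (λ x → c * x * E) (^-+ c i r)))
    eq₁ : n ℕ.* suc k ≡ n ℕ.* k ℕ.+ n
    eq₁ = trans (ℕ.*-suc n k) (ℕ.+-comm n (n ℕ.* k))
    fold : ∀ l k → suc l ℕ.* suc k ≡ suc l ℕ.* k ℕ.+ suc l → ∀ {x} → x ≡ suc l ℕ.* k ℕ.+ l →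
      (suc l ℕ.* suc k) ℕ.* x ! ≡ (suc l ℕ.* k ℕ.+ suc l) !
    fold l k eq refl = trans (cong (ℕ._* (suc l ℕ.* k ℕ.+ l) !) (trans eq (ℕ.+-suc (suc l ℕ.* k) l))) (cong _! (sym (ℕ.+-suc (suc l ℕ.* k) l)))

module HypergeometricTerm (e : ℕ) (ℓ : ℤ) where

  private d = 2+ e

  argument : ℚ
  argument = (fromℕ (suc e) ^ suc e) ⁻¹ * (fromℤ ℓ ^ d) ⁻¹

  -- `∏-pochhammer` for n = d gives the numerator, with (dk+i)!, and for n = d-1 the denominator,
  -- with ((d-1)k+i)!. The two factors i! cancel, and the remaining k! completes the binomial
  -- coefficient. The argument removes (d-1)⁽ᵈ⁻¹⁾ᵏ and brings in the power of ℓ that combines with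
  -- dᵈᵏ.
  hypergeometric-term : ℓ ≢ 0ℤ → ∀ {i} → i ℕ.≤ e → ∀ k →
    hypergeometric (α⁽ i ⁾ d) (β⁽ i ⁾ d) k * argument ^ k * fromℤ ((+ d ℤ.* ℓ) ℤ.^ (d ℕ.* k))
      ≡ fromℕ ((d ℕ.* k ℕ.+ i) C k)
  -- Both sides are multiplied by k! ((d-1)k+i)!, the denominator of the binomial coefficient; `r`
  -- is the number of unshifted β-parameters.
  hypergeometric-term ℓ≢0 {i} i≤e k with r , refl ← ℕ.m≤n⇒∃[o]m+o≡n i≤e = *-cancelʳ (K * G) (*-≢0 (!≢0 k) (!≢0 g)) (begin
    a * u * w * fromℤ ((+ d ℤ.* ℓ) ℤ.^ (d ℕ.* k)) * (K * G)
      ≡⟨ cong₂ (λ x y → a * u * w * x * (K * y)) D^ (sym bKEI) ⟩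
    a * u * w * (Dd * L) * (K * (b * (K * (Ee * I))))
      ≡⟨ solve 9 (λ a u w D L K b E I → a :* u :* w :* (D :* L) :* (K :* (b :* (K :* (E :* I)))) :=
                    (u :* (b :* K)) :* (w :* (E :* L)) :* (a :* (K :* (D :* I)))) refl a u w Dd L K b Ee I ⟩
    (u * (b * K)) * (w * (Ee * L)) * (a * (K * (Dd * I)))
      ≡⟨ cong₂ _*_ (cong₂ _*_ (⁻¹-inverseˡ bK≢0) w-inverse) aKDI ⟩
    1ℚ * 1ℚ * fromℕ (f !)
      ≡⟨ ℚ.*-identityˡ (fromℕ (f !)) ⟩
    fromℕ (f !)
      ≡⟨ cong fromℕ (nCk*k![n∸k]!≡n! {f} {k} k≤f) ⟨
    fromℕ ((f C k) ℕ.* (k ! ℕ.* (f ∸ k) !))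
      ≡⟨ cong (λ x → fromℕ ((f C k) ℕ.* (k ! ℕ.* x !))) f∸k ⟩
    fromℕ ((f C k) ℕ.* (k ! ℕ.* g !))
      ≡⟨ trans (fromℕ-* (f C k) (k ! ℕ.* g !)) (cong (fromℕ (f C k) *_) (fromℕ-* (k !) (g !))) ⟩
    fromℕ (f C k) * (K * G) ∎)
    where
    open ≡-Reasoning
    f = d ℕ.* k ℕ.+ i
    g = suc e ℕ.* k ℕ.+ i
    f≡k+g : f ≡ k ℕ.+ g
    f≡k+g = ℕ.+-assoc k (suc e ℕ.* k) i
    k≤f : k ℕ.≤ f
    k≤f = subst (k ℕ.≤_) (sym f≡k+g) (ℕ.m≤m+n k g)
    f∸k : f ∸ k ≡ g
    f∸k = trans (cong (_∸ k) f≡k+g) (ℕ.m+n∸m≡n k g)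
    a = ∏ (α⁽ i ⁾ d) (λ x → pochhammer x k)
    b = ∏ (β⁽ i ⁾ d) (λ x → pochhammer x k)
    K = fromℕ (k !)
    G = fromℕ (g !)
    I = fromℕ (i !)
    u = (b * K) ⁻¹
    w = argument ^ k
    Dd = fromℕ d ^ (d ℕ.* k)
    Ee = fromℕ (suc e) ^ (suc e ℕ.* k)
    L = (fromℤ ℓ ^ d) ^ k
    bKEI : b * (K * (Ee * I)) ≡ G
    bKEI = ∏-pochhammer i r k
    aKDI : a * (K * (Dd * I)) ≡ fromℕ (f !)
    aKDI = subst (λ n → ∏ (incrementFirst i (fractions (suc n))) (λ x → pochhammer x k) *
      (K * (fromℕ (suc n) ^ (suc n ℕ.* k) * I)) ≡ fromℕ ((suc n ℕ.* k ℕ.+ i) !)) (ℕ.+-suc i r) (∏-pochhammer i (suc r) k)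
    -- Nonvanishing is read off from the evaluation: a multiple of this product is a factorial.
    bK≢0 : b * K ≢ 0ℚ
    bK≢0 = *-≢0ˡ (Ee * I) (subst (_≢ 0ℚ) (sym (trans (ℚ.*-assoc b K (Ee * I)) bKEI)) (!≢0 g))
    D^ : fromℤ ((+ d ℤ.* ℓ) ℤ.^ (d ℕ.* k)) ≡ Dd * L
    D^ = trans (fromℤ-^ (+ d ℤ.* ℓ) (d ℕ.* k)) (trans (cong (_^ (d ℕ.* k)) (fromℤ-* (+ d) ℓ))
      (trans (^-distribʳ-*ℚ (fromℕ d) (fromℤ ℓ) (d ℕ.* k)) (cong (Dd *_) (^-* (fromℤ ℓ) d k))))
    ℓᵈ≢0 : fromℤ ℓ ^ d ≢ 0ℚ
    ℓᵈ≢0 = ^-≢0 (fromℤ ℓ) d (ℓ≢0 ∘ fromℤ-injective ℓ 0ℤ)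
    E^E = fromℕ (suc e) ^ suc e
    E^E≢0 : E^E ≢ 0ℚ
    E^E≢0 = ^-≢0 (fromℕ (suc e)) (suc e) (fromℕ≢0 (suc e) λ ())
    w-inverse : w * (Ee * L) ≡ 1ℚ
    w-inverse = begin
      w * (Ee * L)                                ≡⟨ cong (λ x → w * (x * L)) (^-* (fromℕ (suc e)) (suc e) k) ⟩
      w * (E^E ^ k * L)                           ≡⟨ cong (w *_) (^-distribʳ-*ℚ E^E (fromℤ ℓ ^ d) k) ⟨
      w * (E^E * fromℤ ℓ ^ d) ^ k                 ≡⟨ ^-distribʳ-*ℚ argument (E^E * fromℤ ℓ ^ d) k ⟨
      (argument * (E^E * fromℤ ℓ ^ d)) ^ k
        ≡⟨ cong (_^ k) (solve 4 (λ x y x′ y′ → x :* y :* (x′ :* y′) := x :* x′ :* (y :* y′)) refl (E^E ⁻¹) ((fromℤ ℓ ^ d) ⁻¹) E^E (fromℤ ℓ ^ d)) ⟩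
      (E^E ⁻¹ * E^E * ((fromℤ ℓ ^ d) ⁻¹ * fromℤ ℓ ^ d)) ^ k ≡⟨ cong₂ (λ x y → (x * y) ^ k) (⁻¹-inverseˡ E^E≢0) (⁻¹-inverseˡ ℓᵈ≢0) ⟩
      1ℚ ^ k                                      ≡⟨ 1^ k ⟩
      1ℚ                                          ∎

-- Reduction of rational numbers modulo p

*-↧≡↥ : ∀ x → x * fromℤ (↧ x) ≡ fromℤ (↥ x)
*-↧≡↥ x@(mkℚ n d _) = trans (cong (x *_) (fromℤ≡mkℚ (↧ x)))
  (ℚ.fromℚᵘ-cong {ℚᵘ.mkℚᵘ (n ℤ.* + suc d) (d ℕ.* 1)} {ℚᵘ.mkℚᵘ n 0}
    (ℚᵘ.*≡* (trans (ℤ.*-identityʳ (n ℤ.* + suc d)) (cong (λ y → n ℤ.* + suc y) (sym (ℕ.*-identityʳ d))))))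

fromℕ-mono-≤ : ∀ {a b} → a ℕ.≤ b → fromℕ a ℚ.≤ fromℕ b
fromℕ-mono-≤ {a} {b} a≤b = subst₂ ℚ._≤_ (sym (fromℤ≡mkℚ (+ a))) (sym (fromℤ≡mkℚ (+ b)))
  (ℚ.*≤* (ℤ.*-monoʳ-≤-nonNeg 1ℤ (ℤ.+≤+ a≤b)))

fromℕ-cancel-≤ : ∀ a b → fromℕ a ℚ.≤ fromℕ b → a ℕ.≤ b
fromℕ-cancel-≤ a b h = ℤ.drop‿+≤+ (subst₂ ℤ._≤_ (ℤ.*-identityʳ (+ a)) (ℤ.*-identityʳ (+ b))
  (ℚ.drop-*≤* (subst₂ ℚ._≤_ (fromℤ≡mkℚ (+ a)) (fromℤ≡mkℚ (+ b)) h)))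

÷-*-cancel : ∀ a b → fromℕ a ÷ fromℕ (suc b) * fromℕ (suc b) ≡ fromℕ a
÷-*-cancel a b = trans (ℚ.*-assoc (fromℕ a) (fromℕ (suc b) ⁻¹) (fromℕ (suc b)))
  (trans (cong (fromℕ a *_) (⁻¹-inverseˡ (fromℕ≢0 (suc b) λ ()))) (ℚ.*-identityʳ (fromℕ a)))

÷-≤⁺ : ∀ a b k → a ℕ.≤ k ℕ.* suc b → fromℕ a ÷ fromℕ (suc b) ℚ.≤ fromℕ k
÷-≤⁺ a b k h = ℚ.*-cancelʳ-≤-pos (fromℕ (suc b)) {{ℚ.normalize-pos (suc b) 1}}
  (subst₂ ℚ._≤_ (sym (÷-*-cancel a b)) (fromℕ-* k (suc b)) (fromℕ-mono-≤ h))

÷-≤⁻ : ∀ a b k → fromℕ a ÷ fromℕ (suc b) ℚ.≤ fromℕ k → a ℕ.≤ k ℕ.* suc b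
÷-≤⁻ a b k h = fromℕ-cancel-≤ a (k ℕ.* suc b)
  (subst₂ ℚ._≤_ (÷-*-cancel a b) (sym (fromℕ-* k (suc b)))
    (ℚ.*-monoʳ-≤-nonNeg (fromℕ (suc b)) {{ℚ.normalize-nonNeg (suc b) 1}} h))

*÷-cancel : ∀ a b → fromℕ (a ℕ.* suc b) ÷ fromℕ (suc b) ≡ fromℕ a
*÷-cancel a b = *-cancelʳ (fromℕ (suc b)) (fromℕ≢0 (suc b) λ ()) (trans (÷-*-cancel (a ℕ.* suc b) b) (fromℕ-* a (suc b)))

fromℕ-pred : ∀ a → fromℕ (suc a) - 1ℚ ≡ fromℕ a
fromℕ-pred a = trans (cong (_- 1ℚ) (fromℤ-+ 1ℤ (+ a))) (solve 2 (λ o x → o :+ x :- o := x) refl 1ℚ (fromℕ a))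

floor-fromℕ : ∀ a → ℤ.∣ floor (fromℕ a) ∣ ≡ a
floor-fromℕ a = trans (cong (ℤ.∣_∣ ∘ floor) (fromℤ≡mkℚ (+ a))) (trans (cong ℤ.∣_∣ (ℤ/.div-pos-is-/ℕ (+ a) 1)) (ℕ.n/1≡n a))

module Reduction {m : ℕ} (prime : Prime (2+ m)) where

  open PrimeField prime
  open ModularArithmetic p

  -- x ↦ a says that x lies in ℤ₍ₚ₎ and has residue a; den need not be the reduced denominator.
  infix 4 _↦_
  record _↦_ (x : ℚ) (a : ℤ) : Set where
    constructor reduction
    field
      num den : ℤ
      den≉0   : ¬ den ≈ 0ℤ
      x*den   : x * fromℤ den ≡ fromℤ num
      num≈    : num ≈ a ℤ.* den

  ↦-0 : 0ℚ ↦ 0ℤ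
  ↦-0 = reduction 0ℤ 1ℤ 1≉0 refl ≈-refl

  ↦-cong : ∀ {x a b} → a ≈ b → x ↦ a → x ↦ b
  ↦-cong a≈b (reduction n d d≉0 eq n≈) = reduction n d d≉0 eq (≈-trans n≈ (*-congʳ d a≈b))

  ↦-+ : ∀ {x y a b} → x ↦ a → y ↦ b → x + y ↦ a ℤ.+ b
  ↦-+ {x} {y} {a} {b} (reduction n d d≉0 eq n≈) (reduction n′ d′ d′≉0 eq′ n′≈) =
    reduction (n ℤ.* d′ ℤ.+ n′ ℤ.* d) (d ℤ.* d′) (λ h → [ d≉0 , d′≉0 ]′ (euclid {d} h)) (begin
      (x + y) * fromℤ (d ℤ.* d′)                   ≡⟨ cong ((x + y) *_) (fromℤ-* d d′) ⟩
      (x + y) * (fromℤ d * fromℤ d′)               ≡⟨ solve 4 (λ x y d d′ → (x :+ y) :* (d :* d′) := x :* d :* d′ :+ y :* d′ :* d) refl x y (fromℤ d) (fromℤ d′) ⟩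
      x * fromℤ d * fromℤ d′ + y * fromℤ d′ * fromℤ d ≡⟨ cong₂ (λ u v → u * fromℤ d′ + v * fromℤ d) eq eq′ ⟩
      fromℤ n * fromℤ d′ + fromℤ n′ * fromℤ d      ≡⟨ cong₂ _+_ (fromℤ-* n d′) (fromℤ-* n′ d) ⟨
      fromℤ (n ℤ.* d′) + fromℤ (n′ ℤ.* d)          ≡⟨ fromℤ-+ (n ℤ.* d′) (n′ ℤ.* d) ⟨
      fromℤ (n ℤ.* d′ ℤ.+ n′ ℤ.* d)                ∎)
      (≈-trans (+-cong (*-congʳ d′ n≈) (*-congʳ d n′≈)) (reflexive (expand a b d d′)))
    where
    open ≡-Reasoning
    expand : ∀ a b d d′ → a ℤ.* d ℤ.* d′ ℤ.+ b ℤ.* d′ ℤ.* d ≡ (a ℤ.+ b) ℤ.* (d ℤ.* d′)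
    expand = solve-∀

  ∑-upTo-↦ : ∀ n (f : ℕ → ℚ) (h : ℕ → ℤ) → (∀ k → k < n → f k ↦ h k) → ∑ (upTo n) f ↦ Σ n h
  ∑-upTo-↦ n f h = go n id h
    where
    go : ∀ n (g : ℕ → ℕ) h → (∀ k → k < n → f (g k) ↦ h k) → ∑ (applyUpTo g n) f ↦ Σ n h
    go zero    g h f↦h = ↦-0
    go (suc n) g h f↦h = ↦-+ (f↦h 0 z<s) (go n (g ∘ suc) (h ∘ suc) (λ k k<n → f↦h (suc k) (s<s k<n)))

  ∑-filter-upTo-↦ : ∀ {P : ℕ → Set} (P? : Decidable P) n (f : ℕ → ℚ) (h : ℕ → ℤ) →
    (∀ k → k < n → P k → f k ↦ h k) → (∀ k → k < n → ¬ P k → h k ≈ 0ℤ) → ∑ (filter P? (upTo n)) f ↦ Σ n h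
  ∑-filter-upTo-↦ {P} P? n f h = go n id h
    where
    go : ∀ n (g : ℕ → ℕ) h → (∀ k → k < n → P (g k) → f (g k) ↦ h k) → (∀ k → k < n → ¬ P (g k) → h k ≈ 0ℤ) →
      ∑ (filter P? (applyUpTo g n)) f ↦ Σ n h
    go zero    g h f↦h none = ↦-0
    go (suc n) g h f↦h none with P? (g 0) | go n (g ∘ suc) (h ∘ suc) (λ k k<n → f↦h (suc k) (s<s k<n)) (λ k k<n → none (suc k) (s<s k<n))
    ... | yes P0 | rest = ↦-+ (f↦h 0 z<s P0) rest
    ... | no ¬P0 | rest = ↦-cong (≈-trans (reflexive (sym (ℤ.+-identityˡ _))) (+-cong (≈-sym (none 0 z<s ¬P0)) ≈-refl)) rest

  -- If p divided the reduced denominator of x, cross-multiplying x d = n would make p divide the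
  -- numerator as well, d being prime to p, against lowest terms.
  *-integral⇒Localized : ∀ x n d → ¬ d ≈ 0ℤ → x * fromℤ d ≡ fromℤ n → Localized p x
  *-integral⇒Localized x@(mkℚ _ _ c) n d d≉0 eq {i} (i∣p , i∣↧) with prime⇒irreducible prime i∣p
  ... | inj₁ i≡1  = i≡1
  ... | inj₂ refl = contradiction (Coprimality.recompute c (p∣↥ , i∣↧)) λ ()
    where
    open ≡-Reasoning
    cross : ↥ x ℤ.* d ≡ n ℤ.* ↧ x
    cross = fromℤ-injective (↥ x ℤ.* d) (n ℤ.* ↧ x) (begin
      fromℤ (↥ x ℤ.* d)             ≡⟨ fromℤ-* (↥ x) d ⟩
      fromℤ (↥ x) * fromℤ d         ≡⟨ cong (_* fromℤ d) (*-↧≡↥ x) ⟨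
      x * fromℤ (↧ x) * fromℤ d     ≡⟨ solve 3 (λ x u v → x :* u :* v := x :* v :* u) refl x (fromℤ (↧ x)) (fromℤ d) ⟩
      x * fromℤ d * fromℤ (↧ x)     ≡⟨ cong (_* fromℤ (↧ x)) eq ⟩
      fromℤ n * fromℤ (↧ x)         ≡⟨ fromℤ-* n (↧ x) ⟨
      fromℤ (n ℤ.* ↧ x)             ∎)
    p∣↥ : p ∣ ℤ.∣ ↥ x ∣
    p∣↥ = ≈0⇒∣ ([ id , (λ h → contradiction h d≉0) ]′ (euclid {↥ x} {d}
      (≈-trans (reflexive cross) (*-zero-congʳ n (∣⇒≈0 {↧ x} i∣↧)))))

  ↦⇒≡ : ∀ {x a} → x ↦ a → fromℤ a ≡ x [ℤ₍ p ₎]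
  ↦⇒≡ {x} {a} (reduction n d d≉0 eq (modulo (ℤ∣.divides q n-ad≡qp))) =
      *-integral⇒Localized (fromℤ a) a 1ℤ 1≉0 (ℚ.*-identityʳ (fromℤ a))
    , *-integral⇒Localized x n d d≉0 eq
    , c
    , *-integral⇒Localized c (ℤ.- q) d d≉0 c*d
    , *-cancelʳ (fromℤ d) d≢0 (begin
        (fromℤ a - x) * fromℤ d            ≡⟨ solve 3 (λ a x d → (a :- x) :* d := a :* d :- x :* d) refl (fromℤ a) x (fromℤ d) ⟩
        fromℤ a * fromℤ d - x * fromℤ d    ≡⟨ cong (fromℤ a * fromℤ d -_) eq ⟩
        fromℤ a * fromℤ d - fromℤ n        ≡⟨ cong (_- fromℤ n) (trans (sym (fromℤ-* a d)) (trans (cong fromℤ ad≡) (fromℤ-+ n (+ p ℤ.* ℤ.- q)))) ⟩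
        fromℤ n + fromℤ (+ p ℤ.* ℤ.- q) - fromℤ n ≡⟨ solve 2 (λ u v → u :+ v :- u := v) refl (fromℤ n) (fromℤ (+ p ℤ.* ℤ.- q)) ⟩
        fromℤ (+ p ℤ.* ℤ.- q)              ≡⟨ fromℤ-* (+ p) (ℤ.- q) ⟩
        fromℕ p * fromℤ (ℤ.- q)            ≡⟨ cong (fromℕ p *_) c*d ⟨
        fromℕ p * (c * fromℤ d)            ≡⟨ ℚ.*-assoc (fromℕ p) c (fromℤ d) ⟨
        fromℕ p * c * fromℤ d              ∎)
    where
    open ≡-Reasoning
    -- From x = n/d and n - ad = qp it follows that a - x = p (-q/d).
    c = fromℤ (ℤ.- q) * fromℤ d ⁻¹
    d≢0 : fromℤ d ≢ 0ℚ
    d≢0 h = d≉0 (reflexive (fromℤ-injective d 0ℤ h))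
    c*d : c * fromℤ d ≡ fromℤ (ℤ.- q)
    c*d = trans (ℚ.*-assoc (fromℤ (ℤ.- q)) (fromℤ d ⁻¹) (fromℤ d))
      (trans (cong (fromℤ (ℤ.- q) *_) (⁻¹-inverseˡ d≢0)) (ℚ.*-identityʳ (fromℤ (ℤ.- q))))
    ad≡ : a ℤ.* d ≡ n ℤ.+ + p ℤ.* ℤ.- q
    ad≡ = trans (split n (a ℤ.* d)) (trans (cong (ℤ._-_ n) n-ad≡qp) (negate n q (+ p)))
      where split : ∀ n y → y ≡ n ℤ.- (n ℤ.- y)
            split = solve-∀
            negate : ∀ n q p → n ℤ.- q ℤ.* p ≡ n ℤ.+ p ℤ.* ℤ.- q
            negate = solve-∀

-- Matching the truncated series with the point count

module TruncatedSeries {m : ℕ} (prime : Prime (2+ m)) (e q : ℕ) (N≡qd : suc m ≡ q ℕ.* 2+ e) (ℓ : ℤ) (p∤ℓ : ¬ (+ (2+ m) ℤ.∣ ℓ)) where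

  open PrimeField prime
  open ModularArithmetic p
  open Reduction prime
  open PointDifference prime e ℓ using (D; contribution; numberOfPoints-difference)
  open HypergeometricTerm e ℓ

  private
    d = 2+ e
    N = suc m

  -- The bounds of the i-th truncation over ℕ: the lower one is cleared of its denominator d - 1,
  -- and because p - 1 = qd the upper one is the integer (i+1)q - 1.
  InRange : ℕ → ℕ → Set
  InRange i k = i ℕ.* N ℕ.≤ k ℕ.* suc e × k < suc i ℕ.* q

  inRange? : ∀ i k → Dec (InRange i k)
  inRange? i k = (i ℕ.* N ℕ.≤? k ℕ.* suc e) ×-dec (k ℕ.<? suc i ℕ.* q)

  -- Padding with zeros gives all truncations the common index set k < p, so that the sum over i can
  -- be moved inside.
  term : ℕ → ℕ → ℤ
  term i k = if does (inRange? i k) then contribution k else 0ℤ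

  term-yes : ∀ i k → InRange i k → term i k ≡ contribution k
  term-yes i k h = cong (if_then contribution k else 0ℤ) (dec-true (inRange? i k) h)

  term-no : ∀ i k → ¬ InRange i k → term i k ≡ 0ℤ
  term-no i k h = cong (if_then contribution k else 0ℤ) (dec-false (inRange? i k) h)

  k<[1+i]q⇒dk<[1+i]N : ∀ i k → k < suc i ℕ.* q → d ℕ.* k < suc i ℕ.* N
  k<[1+i]q⇒dk<[1+i]N i k k< = subst (d ℕ.* k <_) (trans (ℕ.*-comm d (suc i ℕ.* q)) (trans (ℕ.*-assoc (suc i) q d) (cong (suc i ℕ.*_) (sym N≡qd))))
    (ℕ.*-monoʳ-< d k<)

  -- In the i-th range iN ≤ (d-1)k ≤ dk < (i+1)N, so i is the quotient of dk by N. In particular the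
  -- ranges are disjoint.
  remainder : ∀ i k → InRange i k → d ℕ.* k ≡ (d ℕ.* k) ℕ.% N ℕ.+ i ℕ.* N
  remainder i k (iN≤ , k<) = trans dk≡ (cong (ℕ._+ i ℕ.* N) (sym (trans (cong (ℕ._% N) dk≡)
      (trans (ℕ.[m+kn]%n≡m%n r i N) (ℕ.m<n⇒m%n≡m r<N)))))
    where
    r = d ℕ.* k ∸ i ℕ.* N
    dk≡ : d ℕ.* k ≡ r ℕ.+ i ℕ.* N
    dk≡ = sym (ℕ.m∸n+n≡m (ℕ.≤-trans iN≤ (ℕ.≤-trans (ℕ.≤-reflexive (ℕ.*-comm k (suc e))) (ℕ.m≤n+m (suc e ℕ.* k) k))))
    r<N : r < N
    r<N = ℕ.+-cancelʳ-< (i ℕ.* N) r N (subst (_< suc i ℕ.* N) dk≡ (k<[1+i]q⇒dk<[1+i]N i k k<))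

  Σ-term : ∀ k → k < p → Σ (suc e) (λ i → term i k) ≈ contribution k
  Σ-term k k<p with k ℕ.≤? (d ℕ.* k) ℕ.% N
  ... | yes k≤r = ≈-trans (Σ-single i₀<1+e (λ i → term i k) others) (reflexive (term-yes i₀ k inRange))
    where
    r = (d ℕ.* k) ℕ.% N
    i₀ = (d ℕ.* k) ℕ./ N
    dk≡ : d ℕ.* k ≡ r ℕ.+ i₀ ℕ.* N
    dk≡ = ℕ.m≡m%n+[m/n]*n (d ℕ.* k) N
    r<N : r < N
    r<N = ℕ.m%n<n (d ℕ.* k) N
    i₀N≤ : i₀ ℕ.* N ℕ.≤ k ℕ.* suc e
    -- Cancel k from k + i₀N ≤ r + i₀N = dk = k + (d-1)k.
    i₀N≤ = ℕ.+-cancelˡ-≤ k (i₀ ℕ.* N) (k ℕ.* suc e) (ℕ.≤-trans (ℕ.+-monoˡ-≤ (i₀ ℕ.* N) k≤r)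
      (ℕ.≤-reflexive (trans (sym dk≡) (cong (k ℕ.+_) (ℕ.*-comm (suc e) k)))))
    inRange : InRange i₀ k
    inRange = i₀N≤ , ℕ.*-cancelʳ-< d k (suc i₀ ℕ.* q) (subst₂ _<_ (ℕ.*-comm d k) (trans (cong (suc i₀ ℕ.*_) N≡qd) (sym (ℕ.*-assoc (suc i₀) q d)))
      (subst (_< suc i₀ ℕ.* N) (sym dk≡) (ℕ.+-monoˡ-< (i₀ ℕ.* N) r<N)))
    i₀<1+e : i₀ < suc e
    -- Were i₀ ≥ d - 1, the lower bound would give (d-1)N ≤ (d-1)k, hence N ≤ k ≤ r, against r < N.
    i₀<1+e = ℕ.≰⇒> λ 1+e≤i₀ → ℕ.<⇒≱ r<N (ℕ.≤-trans (ℕ.*-cancelʳ-≤ N k (suc e) (ℕ.≤-trans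
      (ℕ.≤-reflexive (ℕ.*-comm N (suc e))) (ℕ.≤-trans (ℕ.*-monoˡ-≤ N 1+e≤i₀) i₀N≤))) k≤r)
    others : ∀ i → i < suc e → i ≢ i₀ → term i k ≈ 0ℤ
    others i _ i≢i₀ = reflexive (term-no i k λ h → i≢i₀ (ℕ.*-cancelʳ-≡ i i₀ N
      (ℕ.+-cancelˡ-≡ r (i ℕ.* N) (i₀ ℕ.* N) (trans (sym (remainder i k h)) dk≡))))
  ... | no k≰r = ≈-trans (Σ-zero (suc e) (λ i _ → vanish i)) (≈-sym contribution≈0)
    where
    contribution≈0 : contribution k ≈ 0ℤ
    contribution≈0 = *-zero-congˡ (D ℤ.^ (N ∸ (d ℕ.* k) ℕ.% N)) (reflexive (cong +_ (k>n⇒nCk≡0 (ℕ.≰⇒> k≰r))))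
    vanish : ∀ i → term i k ≈ 0ℤ
    vanish i with inRange? i k
    ... | yes h = ≈-trans (reflexive (term-yes i k h)) contribution≈0
    ... | no ¬h = reflexive (term-no i k ¬h)

  ΣΣ-term : Σ (suc e) (λ i → Σ p (term i)) ≈ Σ p contribution
  ΣΣ-term = ≈-trans (Σ-comm (suc e) p term) (Σ-cong p Σ-term)

  ℓ≢0 : ℓ ≢ 0ℤ
  ℓ≢0 refl = p∤ℓ (divides 0 refl)

  q>0 : 0 < q
  q>0 = ℕ.n≢0⇒n>0 λ where refl → contradiction N≡qd λ ()

  -- As a divisor of p - 1, d lies strictly between 0 and p and is a unit mod p.
  D≉0 : ¬ D ≈ 0ℤ
  D≉0 h = [ <p⇒≉0 z<s (s<s d≤N) , p∤ℓ ∘ ≈0⇒∣ ]′ (euclid {+ d} {ℓ} h)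
    where
    d≤N : d ℕ.≤ N
    d≤N = subst (d ℕ.≤_) (sym N≡qd) (ℕ.m≤n*m d q {{ℕ.>-nonZero q>0}})

  -- The exact denominator Dᵈᵏ turns into the numerator Dᴺ⁻ʳ because N - r + dk = (i+1)N is a
  -- multiple of p - 1, which makes the two powers inverse mod p.
  hypergeometric-↦ : ∀ {i k} → i ℕ.≤ e → k < p → InRange i k →
    hypergeometric (α⁽ i ⁾ d) (β⁽ i ⁾ d) k * argument ^ k ↦ contribution k
  hypergeometric-↦ {i} {k} i≤e k<p h = reduction (+ ((d ℕ.* k ℕ.+ i) C k)) (D ℤ.^ (d ℕ.* k)) (^-≉0 {D} (d ℕ.* k) D≉0)
    (hypergeometric-term ℓ≢0 i≤e k) (begin
      + ((d ℕ.* k ℕ.+ i) C k)                                      ≡⟨ cong (λ x → + (x C k)) top≡ ⟩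
      + ((r ℕ.+ i ℕ.* p) C k)                                      ≈⟨ C-periodic-* r i k<p ⟩
      + (r C k)                                                    ≡⟨ ℤ.*-identityʳ _ ⟨
      + (r C k) ℤ.* 1ℤ                                             ≈⟨ *-congˡ (+ (r C k)) (fermat-unit-* D (suc i) D≉0) ⟨
      + (r C k) ℤ.* D ℤ.^ (suc i ℕ.* N)                            ≡⟨ cong (λ x → + (r C k) ℤ.* D ℤ.^ x) exponent≡ ⟨
      + (r C k) ℤ.* D ℤ.^ (N ∸ r ℕ.+ d ℕ.* k)                      ≡⟨ cong (+ (r C k) ℤ.*_) (ℤ.^-distribˡ-+-* D (N ∸ r) (d ℕ.* k)) ⟩
      + (r C k) ℤ.* (D ℤ.^ (N ∸ r) ℤ.* D ℤ.^ (d ℕ.* k))            ≡⟨ ℤ.*-assoc (+ (r C k)) (D ℤ.^ (N ∸ r)) (D ℤ.^ (d ℕ.* k)) ⟨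
      contribution k ℤ.* D ℤ.^ (d ℕ.* k)                           ∎)
    where
    open ≈-Reasoning
    r = (d ℕ.* k) ℕ.% N
    top≡ : d ℕ.* k ℕ.+ i ≡ r ℕ.+ i ℕ.* p
    top≡ = trans (cong (ℕ._+ i) (remainder i k h)) (trans (ℕ.+-assoc r (i ℕ.* N) i)
      (cong (r ℕ.+_) (trans (ℕ.+-comm (i ℕ.* N) i) (sym (ℕ.*-suc i N)))))
    exponent≡ : N ∸ r ℕ.+ d ℕ.* k ≡ suc i ℕ.* N
    exponent≡ = trans (cong (N ∸ r ℕ.+_) (remainder i k h)) (trans (sym (ℕ.+-assoc (N ∸ r) r (i ℕ.* N)))
      (cong (ℕ._+ i ℕ.* N) (ℕ.m∸n+n≡m (ℕ.<⇒≤ (ℕ.m%n<n (d ℕ.* k) N)))))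

  lower upper : ℕ → ℚ
  lower i = fromℕ (i ℕ.* N) ÷ fromℕ (suc e)
  upper i = fromℕ (suc i ℕ.* N) ÷ fromℕ d - 1ℚ

  suc-pred : ∀ i → suc (ℕ.pred (suc i ℕ.* q)) ≡ suc i ℕ.* q
  suc-pred i = ℕ.suc-pred (suc i ℕ.* q) {{ℕ.m*n≢0 (suc i) q {{_}} {{ℕ.>-nonZero q>0}}}}

  upper≡ : ∀ i → upper i ≡ fromℕ (ℕ.pred (suc i ℕ.* q))
  upper≡ i = trans (cong (λ x → fromℕ x ÷ fromℕ d - 1ℚ) (trans (cong (suc i ℕ.*_) N≡qd) (sym (ℕ.*-assoc (suc i) q d))))
    (trans (cong (_- 1ℚ) (*÷-cancel (suc i ℕ.* q) (suc e)))
    (trans (cong (λ x → fromℕ x - 1ℚ) (sym (suc-pred i))) (fromℕ-pred (ℕ.pred (suc i ℕ.* q)))))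

  truncation-↦ : ∀ i → i < suc e →
    [ hypergeometric (α⁽ i ⁾ d) (β⁽ i ⁾ d) ⟨ argument ⟩]⟨ lower i , upper i ⟩ ↦ Σ p (term i)
  truncation-↦ i (s≤s i≤e) = subst (λ b → [ hypergeometric (α⁽ i ⁾ d) (β⁽ i ⁾ d) ⟨ argument ⟩]⟨ lower i , b ⟩ ↦ Σ p (term i)) (sym (upper≡ i))
    (subst (λ n → ∑ (filter P? (upTo (suc n))) f ↦ Σ p (term i)) (sym (floor-fromℕ s-1))
      (↦-cong (≈-sym (Σ-extend {suc s-1} {p} s≤p (term i) (λ k s≤k _ → reflexive (term-no i k λ h → ℕ.<⇒≱ (proj₂ h) (subst (ℕ._≤ k) (suc-pred i) s≤k)))))
        (∑-filter-upTo-↦ P? (suc s-1) f (term i) inside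
          (λ k k<s ¬P → reflexive (term-no i k λ h → ¬P (÷-≤⁺ (i ℕ.* N) e k (proj₁ h) , fromℕ-mono-≤ (ℕ.s≤s⁻¹ k<s)))))))
    where
    s-1 = ℕ.pred (suc i ℕ.* q)
    -- Since i + 1 ≤ d, the range ends below (i+1)q ≤ dq = p - 1, so the padding up to p adds only
    -- zeros.
    s≤p : suc s-1 ℕ.≤ p
    s≤p = subst (ℕ._≤ p) (sym (suc-pred i)) (ℕ.≤-trans (ℕ.*-monoˡ-≤ q (s≤s (ℕ.m≤n⇒m≤1+n i≤e)))
      (ℕ.≤-trans (ℕ.≤-reflexive (trans (ℕ.*-comm d q) (sym N≡qd))) (ℕ.n≤1+n N)))
    f : ℕ → ℚ
    f k = hypergeometric (α⁽ i ⁾ d) (β⁽ i ⁾ d) k * argument ^ k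
    P : ℕ → Set
    P k = lower i ℚ.≤ fromℕ k × fromℕ k ℚ.≤ fromℕ s-1
    P? : Decidable P
    P? k = (lower i ℚ.≤? fromℕ k) ×-dec (fromℕ k ℚ.≤? fromℕ s-1)
    inside : ∀ k → k < suc s-1 → P k → f k ↦ term i k
    inside k k<s (lower≤k , _) = subst (f k ↦_) (sym (term-yes i k h)) (hypergeometric-↦ i≤e (ℕ.<-≤-trans k<s s≤p) h)
      where
      h : InRange i k
      h = ÷-≤⁻ (i ℕ.* N) e k lower≤k , subst (k <_) (suc-pred i) k<s

  congruence : fromℤ (+ numberOfPoints p d ℓ ℤ.- + numberOfPoints p d 0ℤ)
    ≡ ∑ (upTo (suc e)) (λ i → [ hypergeometric (α⁽ i ⁾ d) (β⁽ i ⁾ d) ⟨ argument ⟩]⟨ lower i , upper i ⟩) [ℤ₍ p ₎]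
  congruence = ↦⇒≡ (↦-cong (≈-trans ΣΣ-term (≈-sym numberOfPoints-difference))
    (∑-upTo-↦ (suc e) _ (λ i → Σ p (term i)) truncation-↦))

theorem5p5 : (d p : ℕ) (ℓ : ℤ) → 2 ℕ.≤ d → Prime p → d ∣ p ∸ 1 → ¬ (+ p ℤ.∣ ℓ) →
    fromℤ (+ numberOfPoints p d ℓ ℤ.- + numberOfPoints p d (+ 0))
    ≡ ∑ (upTo (d ∸ 1)) (λ i →
    [ hypergeometric (α⁽ i ⁾ d) (β⁽ i ⁾ d) ⟨ (fromℕ (d ∸ 1) ^ (d ∸ 1)) ⁻¹ * (fromℤ ℓ ^ d) ⁻¹ ⟩]⟨
    fromℕ (i ℕ.* (p ∸ 1)) ÷ fromℕ (d ∸ 1) ,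
    fromℕ (suc i ℕ.* (p ∸ 1)) ÷ fromℕ d - 1ℚ ⟩)
    [ℤ₍ p ₎]
theorem5p5 (2+ e) (2+ m) ℓ _ p-prime (divides q p-1≡qd) p∤ℓ = TruncatedSeries.congruence p-prime e q p-1≡qd ℓ p∤ℓ
theorem5p5 0      _      _ ()
theorem5p5 1      _      _ (s≤s ())
theorem5p5 (2+ _) 0      _ _ p-prime = contradiction p-prime ¬prime[0]
theorem5p5 (2+ _) 1      _ _ p-prime = contradiction p-prime ¬prime[1]
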